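{- Let $G$ be a finite, simple, connected $3$-$\gamma_{c}$-critical graph with $\delta(G) \geq 2$. If $\kappa(G) \leq \delta(G) - 1$, then $\alpha(G) \leq \kappa(G)$ or $G \in \mathcal{G}_{2}(3,3)$.
   Context: All graphs are finite, simple and connected. A set $D \subseteq V(G)$ is a connected dominating set of $G$ if every vertex of $G$ is in $D$ or adjacent to a vertex of $D$, and $G[D]$ is connected; $\gamma_{c}(G)$ is the minimum size of such a set. For non-adjacent $u,v$, $G+uv$ is $G$ with edge $uv$ added. $G$ is $3$-$\gamma_{c}$-critical if $\gamma_{c}(G)=3$ and $\gamma_{c}(G+uv)<3$ for every pair of non-adjacent vertices $u,v$. $\alpha(G)$ is the independence number, $\delta(G)$ the minimum degree, $\kappa(G)$ the connectivity (minimum size of a vertex set whose removal disconnects $G$). The class $\mathcal{G}_{2}(3,3)$: take integers $j_1, j_2 \geq 3$, pairwise disjoint vertex sets $J_1, J_2$ with $|J_1| = j_1$, $|J_2| = j_2$, two distinct vertices $u_1, u_2 \in J_2$, and three further vertices $w, w_1, v_1$. Form the graph on $J_1 \cup J_2 \cup \{w, w_1, v_1\}$ whose edges are exactly: all edges inside $J_1$, all edges inside $J_2$, $v_1$ joined to every vertex of $J_1$, $w_1$ joined to every vertex of $J_1 \cup (J_2 \setminus \{u_1\}) \cup \{w\}$, and $w$ joined to every vertex of $J_1 \cup (J_2 \setminus \{u_2\}) \cup \{w_1\}$. $\mathcal{G}_{2}(3,3)$ is the class of all graphs (up to isomorphism) obtained this way. -}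

module Defs where

open import Data.Nat using (ℕ; suc; _≤_; _<_)
open import Data.Bool using (Bool; true; false; _∨_; _∧_)
open import Data.Bool.Properties using (∨-comm; ∧-comm)
open import Data.Empty using (⊥-elim)
open import Data.Fin using (Fin; _≟_)
open import Data.Fin.Subset using (Subset; _∈_; _∉_; ∣_∣; ⊤; ∁)
open import Data.Vec using (tabulate)
open import Data.Product using (Σ; ∃; _×_; _,_)
open import Data.Sum using (_⊎_)
open import Relation.Nullary using (¬_; does; yes; no)
open import Relation.Binary.PropositionalEquality using (_≡_; _≢_; refl; trans; cong₂)

record Graph (n : ℕ) : Set where
  field
    adj   : Fin n → Fin n → Bool
    sym   : ∀ u v → adj u v ≡ adj v u
    irrefl : ∀ v → adj v v ≡ false
open Graph public

Adj : ∀ {n} → Graph n → Fin n → Fin n → Set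
Adj G u v = adj G u v ≡ true

isPair : ∀ {n} → Fin n → Fin n → Fin n → Fin n → Bool
isPair u v x y = (does (x ≟ u) ∧ does (y ≟ v)) ∨ (does (x ≟ v) ∧ does (y ≟ u))

addEdge : ∀ {n} (G : Graph n) (u v : Fin n) → u ≢ v → Graph n
addEdge G u v u≢v = record
  { adj = λ x y → adj G x y ∨ isPair u v x y
  ; sym = λ x y → cong₂ _∨_ (Graph.sym G x y) (pairSym x y)
  ; irrefl = irr }
  where
  pairSym : ∀ x y → isPair u v x y ≡ isPair u v y x
  pairSym x y = trans (∨-comm (does (x ≟ u) ∧ does (y ≟ v)) (does (x ≟ v) ∧ does (y ≟ u)))
    (cong₂ _∨_ (∧-comm (does (x ≟ v)) (does (y ≟ u))) (∧-comm (does (x ≟ u)) (does (y ≟ v))))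
  irr : ∀ x → (adj G x x ∨ isPair u v x x) ≡ false
  irr x rewrite Graph.irrefl G x with x ≟ u | x ≟ v
  ... | yes refl | yes refl = ⊥-elim (u≢v refl)
  ... | yes _ | no _ = refl
  ... | no _ | yes _ = refl
  ... | no _ | no _ = refl

data WalkIn {n} (G : Graph n) (D : Subset n) : Fin n → Fin n → Set where
  here : ∀ {u} → u ∈ D → WalkIn G D u u
  step : ∀ {u w v} → u ∈ D → Adj G u w → WalkIn G D w v → WalkIn G D u v

InducedConnected : ∀ {n} → Graph n → Subset n → Set
InducedConnected {n} G D = (∃ λ x → x ∈ D) × (∀ u v → u ∈ D → v ∈ D → WalkIn G D u v)

Connected : ∀ {n} → Graph n → Set
Connected G = InducedConnected G ⊤

Dominating : ∀ {n} → Graph n → Subset n → Set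
Dominating {n} G D = ∀ v → v ∈ D ⊎ (∃ λ u → u ∈ D × Adj G u v)

ConnectedDominating : ∀ {n} → Graph n → Subset n → Set
ConnectedDominating G D = Dominating G D × InducedConnected G D

ConnDomNumber : ∀ {n} → Graph n → ℕ → Set
ConnDomNumber {n} G k =
  (Σ (Subset n) λ D → ConnectedDominating G D × ∣ D ∣ ≡ k) ×
  (∀ D → ConnectedDominating G D → k ≤ ∣ D ∣)

ConnDomLess : ∀ {n} → Graph n → ℕ → Set
ConnDomLess {n} G k = Σ (Subset n) λ D → ConnectedDominating G D × ∣ D ∣ < k

ThreeGammaCCritical : ∀ {n} → Graph n → Set
ThreeGammaCCritical G =
  ConnDomNumber G 3 ×
  (∀ u v (u≢v : u ≢ v) → adj G u v ≡ false → ConnDomLess (addEdge G u v u≢v) 3)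

degree : ∀ {n} → Graph n → Fin n → ℕ
degree G v = ∣ tabulate (adj G v) ∣

MinDegree : ∀ {n} → Graph n → ℕ → Set
MinDegree G d = (∃ λ v → degree G v ≡ d) × (∀ v → d ≤ degree G v)

Separating : ∀ {n} → Graph n → Subset n → Set
Separating G S = ∃ λ u → ∃ λ v → u ∉ S × v ∉ S × ¬ WalkIn G (∁ S) u v

Connectivity : ∀ {n} → Graph n → ℕ → Set
Connectivity {n} G k =
  (Σ (Subset n) λ S → Separating G S × ∣ S ∣ ≡ k) ×
  (∀ S → Separating G S → k ≤ ∣ S ∣)

Independent : ∀ {n} → Graph n → Subset n → Set
Independent G I = ∀ u v → u ∈ I → v ∈ I → adj G u v ≡ false

IndependenceAtMost : ∀ {n} → Graph n → ℕ → Set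
IndependenceAtMost G k = ∀ I → Independent G I → ∣ I ∣ ≤ k

-- Membership in 𝒢₂(3,3), written out on the vertex set of G itself
-- (G is isomorphic to a member of the construction iff its vertices can
-- be labelled as follows).
InG233 : ∀ {n} → Graph n → Set
InG233 {n} G =
  Σ (Subset n) λ J₁ → Σ (Subset n) λ J₂ →
  Σ (Fin n) λ w → Σ (Fin n) λ w₁ → Σ (Fin n) λ v₁ →
  Σ (Fin n) λ u₁ → Σ (Fin n) λ u₂ →
    3 ≤ ∣ J₁ ∣ × 3 ≤ ∣ J₂ ∣ ×
    u₁ ∈ J₂ × u₂ ∈ J₂ × u₁ ≢ u₂ ×
    (∀ x → x ∈ J₁ → x ∉ J₂) ×
    (w ∉ J₁ × w ∉ J₂) × (w₁ ∉ J₁ × w₁ ∉ J₂) × (v₁ ∉ J₁ × v₁ ∉ J₂) ×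
    w ≢ w₁ × w ≢ v₁ × w₁ ≢ v₁ ×
    (∀ x → x ∈ J₁ ⊎ x ∈ J₂ ⊎ x ≡ w ⊎ x ≡ w₁ ⊎ x ≡ v₁) ×
    (∀ x y → Adj G x y ⇔ (E J₁ J₂ w w₁ v₁ u₁ u₂ x y ⊎ E J₁ J₂ w w₁ v₁ u₁ u₂ y x))
  where
  _⇔_ : Set → Set → Set
  A ⇔ B = (A → B) × (B → A)
  E : Subset n → Subset n → (w w₁ v₁ u₁ u₂ : Fin n) → Fin n → Fin n → Set
  E J₁ J₂ w w₁ v₁ u₁ u₂ x y =
      (x ∈ J₁ × y ∈ J₁ × x ≢ y)
    ⊎ (x ∈ J₂ × y ∈ J₂ × x ≢ y)
    ⊎ (x ≡ v₁ × y ∈ J₁)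
    ⊎ (x ≡ w₁ × (y ∈ J₁ ⊎ (y ∈ J₂ × y ≢ u₁) ⊎ y ≡ w))
    ⊎ (x ≡ w × (y ∈ J₁ ⊎ (y ∈ J₂ × y ≢ u₂) ⊎ y ≡ w₁))

-- Write uy → v (Arc u y v) when u ~ y and {u, y} dominates every vertex but v.
-- In a 3-γc-critical graph no edge dominates, and non-adjacent u, v either
-- form a dominating pair or satisfy uy → v or vy → u for some y.  So an
-- independent set I with at least three vertices carries a tournament, and the
-- witness y of an arc into v is adjacent to all of I except v; witnesses of
-- arcs with distinct heads are therefore distinct.
--
-- Let S be a minimum cut, A and B the two sides.  An arc leaving A has its
-- witness in S, and this witness is complete to B apart from the head.  Both
-- sides have at least two vertices since δ > |S|, and |S| = 1 is excluded
-- directly.  If |I| > |S| ≥ 2, matching the vertices of S ∩ I with themselves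
-- and the other heads with their witnesses leaves exactly one vertex a of I
-- without an arc into it from I ∖ S, and every vertex of S ∖ I witnesses an
-- arc out of a.  A case analysis on where I meets S, A and B excludes
-- everything but S = {x, s}, I = {a, x, b} with a ∈ A and b ∈ B, and then x,
-- s, b are the vertices w, w₁, v₁ of 𝒢₂(3,3), with u₂ = a and u₁ the only
-- vertex of A missed by s.
module Submission where

open import Defs
open import Data.Nat using (ℕ; _≤_; _+_)
open import Data.Sum using (_⊎_)
open import Data.Nat using (zero; suc; _<_; z≤n; s≤s)
import Data.Nat.Properties as ℕ
open import Data.Bool using (true; false)
open import Data.Bool.Properties using (¬-not; not-¬) renaming (_≟_ to _≟ᵇ_)
open import Data.Empty using (⊥; ⊥-elim)
open import Data.Fin using (Fin; _≟_)
open import Data.Fin.Properties using (any?; all?)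
open import Data.Fin.Subset
  using (Subset; _∈_; _∉_; _⊆_; ∣_∣; ∁; ⁅_⁆; _∪_; _-_; _─_; inside; outside; Empty)
open import Data.Fin.Subset.Properties
open import Data.Product using (Σ; ∃; ∃₂; _×_; _,_; proj₁; proj₂; map₂)
open import Data.Sum using (inj₁; inj₂; [_,_]′; swap; map)
open import Data.Vec using ([]; _∷_; here; there; tabulate)
open import Data.Vec.Properties using (lookup∘tabulate; []=⇒lookup)
open import Function using (_∘_; id; flip)
open import Relation.Nullary using (¬_; Dec; yes; no; contradiction)
open import Relation.Nullary.Decidable using (_×-dec_; _⊎-dec_; _→-dec_; ¬?; map′; decidable-stable)
open import Relation.Binary.PropositionalEquality
  using (_≡_; _≢_; refl; trans; cong; subst; ≢-sym) renaming (sym to ≡-sym)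

-- Cardinalities of finite subsets

private variable
  n : ℕ

∣p∪q∣≤∣p∣+∣q∣ : (p q : Subset n) → ∣ p ∪ q ∣ ≤ ∣ p ∣ + ∣ q ∣
∣p∪q∣≤∣p∣+∣q∣ [] [] = z≤n
∣p∪q∣≤∣p∣+∣q∣ (inside ∷ p) (s ∷ q) =
  s≤s (ℕ.≤-trans (∣p∪q∣≤∣p∣+∣q∣ p q) (ℕ.+-monoʳ-≤ ∣ p ∣ (∣p∣≤∣x∷p∣ s q)))
∣p∪q∣≤∣p∣+∣q∣ (outside ∷ p) (outside ∷ q) = ∣p∪q∣≤∣p∣+∣q∣ p q
∣p∪q∣≤∣p∣+∣q∣ (outside ∷ p) (inside ∷ q) =
  ℕ.≤-trans (s≤s (∣p∪q∣≤∣p∣+∣q∣ p q)) (ℕ.≤-reflexive (≡-sym (ℕ.+-suc ∣ p ∣ ∣ q ∣)))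

x∈p─q⇒x∉q : ∀ {x} (p q : Subset n) → x ∈ p ─ q → x ∉ q
x∈p─q⇒x∉q (_ ∷ p) (inside ∷ q) (there x∈) (there x∈q) = x∈p─q⇒x∉q p q x∈ x∈q
x∈p─q⇒x∉q (_ ∷ p) (outside ∷ q) (there x∈) (there x∈q) = x∈p─q⇒x∉q p q x∈ x∈q

x∈p-y⁻ : ∀ {x} (p : Subset n) y → x ∈ p - y → x ∈ p × x ≢ y
x∈p-y⁻ p y x∈ =
  p─q⊆p p ⁅ y ⁆ x∈ , λ { refl → x∈p─q⇒x∉q p ⁅ y ⁆ x∈ (x∈⁅x⁆ y) }

p⊆p-x∪⁅x⁆ : (p : Subset n) (x : Fin n) → p ⊆ (p - x) ∪ ⁅ x ⁆
p⊆p-x∪⁅x⁆ p x {y} y∈p with y ≟ x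
... | yes refl = x∈p∪q⁺ (inj₂ (x∈⁅x⁆ y))
... | no y≢x = x∈p∪q⁺ (inj₁ (x∈p∧x≢y⇒x∈p-y y∈p y≢x))

∣p∪⁅x⁆∣≤1+∣p∣ : (p : Subset n) (x : Fin n) → ∣ p ∪ ⁅ x ⁆ ∣ ≤ suc ∣ p ∣
∣p∪⁅x⁆∣≤1+∣p∣ p x = ℕ.≤-trans (∣p∪q∣≤∣p∣+∣q∣ p ⁅ x ⁆)
  (ℕ.≤-reflexive (trans (cong (∣ p ∣ +_) (∣⁅x⁆∣≡1 x)) (ℕ.+-comm ∣ p ∣ 1)))

∣p∣≤1+∣p-x∣ : (p : Subset n) (x : Fin n) → ∣ p ∣ ≤ suc ∣ p - x ∣
∣p∣≤1+∣p-x∣ p x = ℕ.≤-trans (p⊆q⇒∣p∣≤∣q∣ (p⊆p-x∪⁅x⁆ p x)) (∣p∪⁅x⁆∣≤1+∣p∣ (p - x) x)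

Empty⇒∣p∣≤m : (p : Subset n) (m : ℕ) → Empty p → ∣ p ∣ ≤ m
Empty⇒∣p∣≤m {n} p m e rewrite Empty-unique e | ∣⊥∣≡0 n = z≤n

∣q∣<∣p∣⇒p⊈q : (p q : Subset n) → ∣ q ∣ < ∣ p ∣ → ∃ λ x → x ∈ p × x ∉ q
∣q∣<∣p∣⇒p⊈q p q lt with any? (λ x → (x ∈? p) ×-dec ¬? (x ∈? q))
... | yes e = e
... | no ¬e = contradiction
  (p⊆q⇒∣p∣≤∣q∣ λ {x} x∈p → decidable-stable (x ∈? q) λ x∉q → ¬e (x , x∈p , x∉q))
  (ℕ.<⇒≱ lt)

three-distinct⇒3≤∣p∣ : ∀ {x y z} (p : Subset n) → x ∈ p → y ∈ p → z ∈ p →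
  y ≢ x → z ≢ x → z ≢ y → 3 ≤ ∣ p ∣
three-distinct⇒3≤∣p∣ p x∈ y∈ z∈ y≢x z≢x z≢y =
  ℕ.≤-trans (s≤s (ℕ.≤-trans (s≤s (ℕ.≤-trans (s≤s z≤n) (x∈p⇒∣p-x∣<∣p∣ z∈″))) (x∈p⇒∣p-x∣<∣p∣ y∈′)))
    (x∈p⇒∣p-x∣<∣p∣ x∈)
  where
  y∈′ = x∈p∧x≢y⇒x∈p-y y∈ y≢x
  z∈″ = x∈p∧x≢y⇒x∈p-y (x∈p∧x≢y⇒x∈p-y z∈ z≢x) z≢y

third-element : (p : Subset n) → 3 ≤ ∣ p ∣ → ∀ x y → ∃ λ z → z ∈ p × z ≢ x × z ≢ y
third-element p 3≤ x y with ∣q∣<∣p∣⇒p⊈q p (⁅ x ⁆ ∪ ⁅ y ⁆)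
  (ℕ.≤-trans (s≤s (ℕ.≤-trans (∣p∪⁅x⁆∣≤1+∣p∣ ⁅ x ⁆ y) (s≤s (ℕ.≤-reflexive (∣⁅x⁆∣≡1 x))))) 3≤)
... | z , z∈ , z∉ = z , z∈ , (λ { refl → z∉ (x∈p∪q⁺ (inj₁ (x∈⁅x⁆ z))) })
                           , (λ { refl → z∉ (x∈p∪q⁺ (inj₂ (x∈⁅x⁆ z))) })

∣p∣≤1⇒unique : ∀ {x y} (p : Subset n) → ∣ p ∣ ≤ 1 → x ∈ p → y ∈ p → x ≡ y
∣p∣≤1⇒unique {x = x} {y} p ≤1 x∈ y∈ with x ≟ y
... | yes e = e
... | no x≢y = contradiction (ℕ.≤-trans (s≤s (ℕ.≤-trans (s≤s z≤n)
  (x∈p⇒∣p-x∣<∣p∣ (x∈p∧x≢y⇒x∈p-y x∈ x≢y)))) (x∈p⇒∣p-x∣<∣p∣ y∈)) (ℕ.≤⇒≯ ≤1)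

∣p∣<3⇒covered : ∀ {x} (p : Subset n) → ∣ p ∣ < 3 → x ∈ p →
  ∃ λ y → y ∈ p × (∀ z → z ∈ p → z ≡ x ⊎ z ≡ y)
∣p∣<3⇒covered {x = x} p <3 x∈ with nonempty? (p - x)
... | no e = x , x∈ , λ z z∈ → inj₁
  (decidable-stable (z ≟ x) λ z≢x → e (z , x∈p∧x≢y⇒x∈p-y z∈ z≢x))
... | yes (y , y∈) = y , proj₁ (x∈p-y⁻ p x y∈) , cover
  where
  cover : ∀ z → z ∈ p → z ≡ x ⊎ z ≡ y
  cover z z∈ with z ≟ x | z ≟ y
  ... | yes e | _ = inj₁ e
  ... | no _ | yes e = inj₂ e
  ... | no z≢x | no z≢y = contradiction
    (three-distinct⇒3≤∣p∣ p x∈ (proj₁ (x∈p-y⁻ p x y∈)) z∈ (proj₂ (x∈p-y⁻ p x y∈)) z≢x z≢y)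
    (ℕ.<⇒≱ <3)

module _ (R : Fin n → Fin n → Set) where

  Total : Subset n → Subset n → Set
  Total p q = ∀ x → x ∈ p → ∃ λ y → y ∈ q × R x y

  Injective : Subset n → Set
  Injective p = ∀ x x′ y → x ∈ p → x′ ∈ p → R x y → R x′ y → x ≡ x′

  -- Pigeonhole for a relation instead of a function. Deleting `x` and one partner `y` preserves
  -- totality, because injectivity lets no other element of `p` use `y`; the bound `m` makes the
  -- recursion structural.
  injective⇒∣p∣≤∣q∣ : ∀ p q → Total p q → Injective p → ∣ p ∣ ≤ ∣ q ∣
  injective⇒∣p∣≤∣q∣ p q = go ∣ p ∣ p q ℕ.≤-refl
    where
    go : ∀ m p q → ∣ p ∣ ≤ m → Total p q → Injective p → ∣ p ∣ ≤ ∣ q ∣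
    go m p q ≤m tot inj with nonempty? p
    ... | no e = Empty⇒∣p∣≤m p ∣ q ∣ e
    go zero p q ≤m tot inj | yes (x , x∈) =
      contradiction (ℕ.≤-trans (x∈p⇒∣p-x∣<∣p∣ x∈) ≤m) λ ()
    go (suc m) p q ≤m tot inj | yes (x , x∈) with tot x x∈
    ... | y , y∈ , Rxy = ℕ.≤-trans (∣p∣≤1+∣p-x∣ p x)
      (ℕ.≤-trans (s≤s (go m (p - x) (q - y)
        (ℕ.≤-pred (ℕ.≤-trans (x∈p⇒∣p-x∣<∣p∣ x∈) ≤m)) tot′ inj′)) (x∈p⇒∣p-x∣<∣p∣ y∈))
      where
      tot′ : Total (p - x) (q - y)
      tot′ x′ x′∈ with x∈p-y⁻ p x x′∈
      ... | x′∈p , x′≢x with tot x′ x′∈p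
      ... | y′ , y′∈ , Rx′y′ = y′ ,
        x∈p∧x≢y⇒x∈p-y y′∈ (λ { refl → x′≢x (inj x′ x y x′∈p x∈ Rx′y′ Rxy) }) , Rx′y′
      inj′ : Injective (p - x)
      inj′ a b c a∈ b∈ = inj a b c (proj₁ (x∈p-y⁻ p x a∈)) (proj₁ (x∈p-y⁻ p x b∈))

-- Dominating pairs

module Domination {n} (G : Graph n) where

  infix 4 _~_ _≁_ _⊵_

  _~_ _≁_ _⊵_ : Fin n → Fin n → Set
  u ~ v = Adj G u v
  u ≁ v = ¬ u ~ v
  u ⊵ v = v ≡ u ⊎ u ~ v

  ~-sym : ∀ {u v} → u ~ v → v ~ u
  ~-sym {u} {v} = trans (Graph.sym G v u)

  ~-irrefl : ∀ {v} → v ≁ v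
  ~-irrefl {v} e with trans (≡-sym e) (irrefl G v)
  ... | ()

  ~⇒≢ : ∀ {u v} → u ~ v → u ≢ v
  ~⇒≢ e refl = ~-irrefl e

  _~?_ : ∀ u v → Dec (u ~ v)
  u ~? v = adj G u v ≟ᵇ true

  ⊵⇒~ : ∀ {u w} → u ⊵ w → w ≢ u → u ~ w
  ⊵⇒~ (inj₁ e) w≢u = contradiction e w≢u
  ⊵⇒~ (inj₂ e) _ = e

  DominatingPair : Fin n → Fin n → Set
  DominatingPair u v = ∀ w → u ⊵ w ⊎ v ⊵ w

  record Arc (u y v : Fin n) : Set where
    constructor arc
    field
      tail~ : u ~ y
      head≁ : y ≁ v
      dominates : ∀ w → w ≢ v → u ⊵ w ⊎ y ⊵ w
  open Arc public

  Arc? : ∀ u y v → Dec (Arc u y v)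
  Arc? u y v with u ~? y | y ~? v | all? (λ w → (w ≟ v) ⊎-dec ((w ≟ u) ⊎-dec (u ~? w)) ⊎-dec ((w ≟ y) ⊎-dec (y ~? w)))
  ... | no ¬p | _ | _ = no (¬p ∘ tail~)
  ... | yes _ | yes q | _ = no (λ a → head≁ a q)
  ... | yes p | no q | yes r = yes (arc p q λ w w≢v → [ (λ e → contradiction e w≢v) , id ]′ (r w))
  ... | yes _ | no _ | no ¬r = no (¬r ∘ λ a w → weaken a w (w ≟ v))
    where
    weaken : Arc u y v → ∀ w → Dec (w ≡ v) → w ≡ v ⊎ u ⊵ w ⊎ y ⊵ w
    weaken a w (yes e) = inj₁ e
    weaken a w (no w≢v) = inj₂ (dominates a w w≢v)

  -- A walk confined to two vertices can leave `x` only by stepping onto `y`. This turns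
  -- connectedness of a dominating set with two vertices into an edge.
  walk-edge : ∀ {D : Subset n} {x y} → (∀ z → z ∈ D → z ≡ x ⊎ z ≡ y) → x ≢ y →
    WalkIn G D x y → x ~ y
  walk-edge cover x≢y (here _) = contradiction refl x≢y
  walk-edge {D} {x} {y} cover x≢y (step _ x~w walk) with cover _ (first walk)
    where
    first : ∀ {a b} → WalkIn G D a b → a ∈ D
    first (here a∈) = a∈
    first (step a∈ _ _) = a∈
  ... | inj₁ refl = walk-edge cover x≢y walk
  ... | inj₂ refl = x~w

  walk-exit : ∀ {D p : Subset n} {u v} → WalkIn G D u v → u ∈ p → v ∉ p →
    ∃₂ λ x y → x ∈ p × y ∉ p × x ~ y
  walk-exit (here _) u∈ v∉ = contradiction u∈ v∉
  walk-exit {p = p} {u} (step {w = w} _ u~w walk) u∈ v∉ with w ∈? p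
  ... | yes w∈ = walk-exit walk w∈ v∉
  ... | no w∉ = u , w , u∈ , w∉ , u~w

  -- The ends of such an edge would be a connected dominating set with fewer than three vertices.
  no-dominating-edge : (∀ D → ConnectedDominating G D → 3 ≤ ∣ D ∣) →
    ∀ {u v} → u ~ v → ¬ DominatingPair u v
  no-dominating-edge min {u} {v} u~v dom = contradiction (min D (domD , (u , u∈) , conn)) (ℕ.<⇒≱ small)
    where
    D = ⁅ u ⁆ ∪ ⁅ v ⁆
    u∈ : u ∈ D
    u∈ = x∈p∪q⁺ (inj₁ (x∈⁅x⁆ u))
    v∈ : v ∈ D
    v∈ = x∈p∪q⁺ (inj₂ (x∈⁅x⁆ v))
    small : ∣ D ∣ < 3
    small = s≤s (ℕ.≤-trans (∣p∪⁅x⁆∣≤1+∣p∣ ⁅ u ⁆ v) (s≤s (ℕ.≤-reflexive (∣⁅x⁆∣≡1 u))))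
    domD : Dominating G D
    domD w with dom w
    ... | inj₁ (inj₁ refl) = inj₁ u∈
    ... | inj₁ (inj₂ e) = inj₂ (u , u∈ , e)
    ... | inj₂ (inj₁ refl) = inj₁ v∈
    ... | inj₂ (inj₂ e) = inj₂ (v , v∈ , e)
    conn : ∀ a b → a ∈ D → b ∈ D → WalkIn G D a b
    conn a b a∈ b∈ with map (x∈⁅y⁆⇒x≡y u) (x∈⁅y⁆⇒x≡y v) (x∈p∪q⁻ ⁅ u ⁆ ⁅ v ⁆ a∈)
                      | map (x∈⁅y⁆⇒x≡y u) (x∈⁅y⁆⇒x≡y v) (x∈p∪q⁻ ⁅ u ⁆ ⁅ v ⁆ b∈)
    ... | inj₁ refl | inj₁ refl = here a∈
    ... | inj₁ refl | inj₂ refl = step a∈ u~v (here b∈)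
    ... | inj₂ refl | inj₁ refl = step a∈ (~-sym u~v) (here b∈)
    ... | inj₂ refl | inj₂ refl = here a∈

-- Adding an edge to a critical graph

module AddedEdge {n} (G : Graph n) (u v : Fin n) (u≢v : u ≢ v) where
  open Domination G
  open Domination (addEdge G u v u≢v) using () renaming (_~_ to _~⁺_; ~-sym to ~⁺-sym; walk-edge to walk-edge⁺) public

  ~⁺⇒~ : ∀ {x y} → x ~⁺ y → x ~ y ⊎ (x ≡ u × y ≡ v) ⊎ (x ≡ v × y ≡ u)
  ~⁺⇒~ {x} {y} e with adj G x y | x ≟ u | y ≟ v | x ≟ v | y ≟ u
  ... | true | _ | _ | _ | _ = inj₁ refl
  ... | false | yes p | yes q | _ | _ = inj₂ (inj₁ (p , q))
  ... | false | _ | _ | yes p | yes q = inj₂ (inj₂ (p , q))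
  ~⁺⇒~ () | false | yes _ | no _ | yes _ | no _
  ~⁺⇒~ () | false | yes _ | no _ | no _ | _
  ~⁺⇒~ () | false | no _ | _ | yes _ | no _
  ~⁺⇒~ () | false | no _ | _ | no _ | _

module _ {n} (G : Graph n) where
  open Domination G

  -- A small connected dominating set of the enlarged graph lies in `{x, y}`, where `x ≡ y` is
  -- possible. It contains `u` or `v`, for otherwise it would serve in `G`. If it contains both, it
  -- is the pair; if it contains only one, the other is the only vertex that can lose domination in
  -- `G`, which gives an arc into it.
  critical-dichotomy : ThreeGammaCCritical G → (∀ x → ∃ λ y → x ~ y) →
    ∀ {u v} → u ≢ v → u ≁ v →
    DominatingPair u v ⊎ (∃ λ y → Arc u y v) ⊎ (∃ λ y → Arc v y u)
  critical-dichotomy ((_ , min) , crit) nbr {u} {v} u≢v u≁v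
    with crit u v u≢v (¬-not u≁v)
  ... | D , (domD , (x , x∈) , conn) , <3 with ∣p∣<3⇒covered D <3 x∈
  ... | y , y∈ , cover = go
    where
    open AddedEdge G u v u≢v
    no-edge = no-dominating-edge min
    In : Fin n → Set
    In a = a ≡ x ⊎ a ≡ y
    dom⁺ : ∀ w → (x ⊵ w ⊎ y ⊵ w) ⊎ (In u × w ≡ v) ⊎ (In v × w ≡ u)
    dom⁺ w with domD w
    ... | inj₁ w∈ = inj₁ (map inj₁ inj₁ (cover w w∈))
    ... | inj₂ (z , z∈ , e) with cover z z∈ | ~⁺⇒~ e
    ... | inj₁ refl | inj₁ z~w = inj₁ (inj₁ (inj₂ z~w))
    ... | inj₂ refl | inj₁ z~w = inj₁ (inj₂ (inj₂ z~w))
    ... | i | inj₂ (inj₁ (refl , q)) = inj₂ (inj₁ (i , q))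
    ... | i | inj₂ (inj₂ (refl , q)) = inj₂ (inj₂ (i , q))
    xy : x ≡ y ⊎ x ~⁺ y
    xy with x ≟ y
    ... | yes e = inj₁ e
    ... | no x≢y = inj₂ (walk-edge⁺ cover x≢y (conn x y x∈ y∈))
    -- A vertex `a` missing at most `b` would form a dominating edge with a neighbour of `b`. This
    -- excludes dominating sets with a single vertex.
    not-single : ∀ {a b} → a ≁ b → ¬ (∀ w → w ≢ b → a ⊵ w)
    not-single {a} {b} a≁b d with a ≟ b | nbr b
    ... | yes refl | c , b~c = no-edge b~c dom
      where
      dom : DominatingPair a c
      dom w with w ≟ a
      ... | yes e = inj₁ (inj₁ e)
      ... | no w≢ = inj₁ (d w w≢)
    ... | no a≢b | c , b~c = no-edge a~c dom
      where
      a~c = ⊵⇒~ (d c (≢-sym (~⇒≢ b~c))) λ { refl → a≁b (~-sym b~c) }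
      dom : DominatingPair a c
      dom w with w ≟ b
      ... | yes refl = inj₂ (inj₂ (~-sym b~c))
      ... | no w≢ = inj₁ (d w w≢)
    half : ∀ {a b z} → a ≁ b → a ≡ z ⊎ a ~ z → (∀ w → w ≢ b → a ⊵ w ⊎ z ⊵ w) → ∃ λ y → Arc a y b
    half {a} {b} a≁b (inj₁ refl) d = contradiction (λ w w≢ → [ id , id ]′ (d w w≢)) (not-single a≁b)
    half {a} {b} {z} a≁b (inj₂ a~z) d with z ~? b
    ... | no z≁b = z , arc a~z z≁b d
    ... | yes z~b = ⊥-elim (no-edge a~z dom)
      where
      dom : DominatingPair a z
      dom w with w ≟ b
      ... | yes refl = inj₂ (inj₂ z~b)
      ... | no w≢ = d w w≢
    v≁u : v ≁ u
    v≁u = u≁v ∘ ~-sym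
    partner : ∀ {a} → In a → ∃ λ z → In z × (a ≡ z ⊎ a ~⁺ z) ×
      (∀ w → x ⊵ w ⊎ y ⊵ w → a ⊵ w ⊎ z ⊵ w) × (∀ b → In b → b ≢ a → b ≡ z)
    partner (inj₁ refl) = y , inj₂ refl , xy , (λ _ → id) ,
      λ b i b≢ → [ (λ e → contradiction e b≢) , id ]′ i
    partner (inj₂ refl) = x , inj₁ refl , map ≡-sym ~⁺-sym xy , (λ _ → swap) ,
      λ b i b≢ → [ id , (λ e → contradiction e b≢) ]′ i
    In? : ∀ a → Dec (In a)
    In? a = (a ≟ x) ⊎-dec (a ≟ y)
    go : DominatingPair u v ⊎ (∃ λ y → Arc u y v) ⊎ (∃ λ y → Arc v y u)
    go with In? u | In? v
    go | yes u∈ | yes v∈ with partner u∈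
    ... | z , _ , _ , d , only with only v v∈ (≢-sym u≢v)
    ... | refl = inj₁ λ w → [ d w , [ inj₂ ∘ inj₁ ∘ proj₂ , inj₁ ∘ inj₁ ∘ proj₂ ]′ ]′ (dom⁺ w)
    go | yes u∈ | no v∉ with partner u∈
    ... | z , z∈ , uz , d , _ = inj₂ (inj₁ (half u≁v (map id (old ∘ ~⁺⇒~) uz)
        λ w w≢v → [ d w , [ (λ p → contradiction (proj₂ p) w≢v) , (λ p → contradiction (proj₁ p) v∉) ]′ ]′ (dom⁺ w)))
      where
      -- The edge from `u` to `z` is not the new one: `z` lies in the dominating set and `v` does
      -- not.
      old : u ~ z ⊎ (u ≡ u × z ≡ v) ⊎ (u ≡ v × z ≡ u) → u ~ z
      old (inj₁ e) = e
      old (inj₂ (inj₁ (_ , refl))) = contradiction z∈ v∉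
      old (inj₂ (inj₂ (e , _))) = contradiction e u≢v
    go | no u∉ | yes v∈ with partner v∈
    ... | z , z∈ , vz , d , _ = inj₂ (inj₂ (half v≁u (map id (old ∘ ~⁺⇒~) vz)
        λ w w≢u → [ d w , [ (λ p → contradiction (proj₁ p) u∉) , (λ p → contradiction (proj₂ p) w≢u) ]′ ]′ (dom⁺ w)))
      where
      old : v ~ z ⊎ (v ≡ u × z ≡ v) ⊎ (v ≡ v × z ≡ u) → v ~ z
      old (inj₁ e) = e
      old (inj₂ (inj₁ (e , _))) = contradiction (≡-sym e) u≢v
      old (inj₂ (inj₂ (_ , refl))) = contradiction z∈ u∉
    go | no u∉ | no v∉ = ⊥-elim (absurd xy)
      where
      dom : DominatingPair x y
      dom w = [ id , [ (λ p → contradiction (proj₁ p) u∉) , (λ p → contradiction (proj₁ p) v∉) ]′ ]′ (dom⁺ w)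
      absurd : x ≡ y ⊎ x ~⁺ y → ⊥
      absurd (inj₁ refl) = no-edge (proj₂ (nbr x)) λ w → inj₁ ([ id , id ]′ (dom w))
      absurd (inj₂ e) with ~⁺⇒~ e
      ... | inj₁ x~y = no-edge x~y dom
      ... | inj₂ (inj₁ (refl , _)) = u∉ (inj₁ refl)
      ... | inj₂ (inj₂ (refl , _)) = v∉ (inj₁ refl)

-- Vertex cuts

-- Each side is a union of components of `G` without `S`. Connected sides are not demanded, which
-- keeps the notion symmetric.
record Cut {n} (G : Graph n) (S A B : Subset n) : Set where
  field
    cover : ∀ v → v ∈ S ⊎ v ∈ A ⊎ v ∈ B
    A∩S : ∀ {v} → v ∈ A → v ∉ S
    B∩S : ∀ {v} → v ∈ B → v ∉ S
    A∩B : ∀ {v} → v ∈ A → v ∉ B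
    no-cross : ∀ {a b} → a ∈ A → b ∈ B → ¬ Adj G a b
    A≢∅ : ∃ λ a → a ∈ A
    B≢∅ : ∃ λ b → b ∈ B

cut-swap : ∀ {n} {G : Graph n} {S A B} → Cut G S A B → Cut G S B A
cut-swap {G = G} cut = record
  { cover = map id swap ∘ cover ; A∩S = B∩S ; B∩S = A∩S ; A∩B = λ b a → A∩B a b
  ; no-cross = λ b a → no-cross a b ∘ Domination.~-sym G ; A≢∅ = B≢∅ ; B≢∅ = A≢∅ }
  where open Cut cut

neighbour-outside : ∀ {n} (G : Graph n) (p : Subset n) v → ∣ p ∣ < degree G v →
  ∃ λ w → Adj G v w × w ∉ p
neighbour-outside G p v lt with ∣q∣<∣p∣⇒p⊈q (tabulate (adj G v)) p lt
... | w , w∈ , w∉ = w , trans (≡-sym (lookup∘tabulate (adj G v) w)) ([]=⇒lookup w∈) , w∉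

degree-≤ : ∀ {n} (G : Graph n) (p : Subset n) v → (∀ w → Adj G v w → w ∈ p) → degree G v ≤ ∣ p ∣
degree-≤ G p v N⊆p = p⊆q⇒∣p∣≤∣q∣ {p = tabulate (adj G v)} λ {w} w∈ →
  N⊆p w (trans (≡-sym (lookup∘tabulate (adj G v) w)) ([]=⇒lookup w∈))

module _ {n} (G : Graph n) (S : Subset n) where
  open Domination G

  walk-snoc : ∀ {D : Subset n} {u v w} → WalkIn G D u v → v ~ w → w ∈ D → WalkIn G D u w
  walk-snoc (here u∈) v~w w∈ = step u∈ v~w (here w∈)
  walk-snoc (step u∈ u~t walk) v~w w∈ = step u∈ u~t (walk-snoc walk v~w w∈)

  -- The component of `u` outside `S`, grown one vertex at a time. The fuel `m` satisfies
  -- `n ≤ m + ∣ P ∣`, so it cannot run out while a vertex can still be added.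
  reachable-set : ∀ {u} → u ∉ S → Σ (Subset n) λ P → u ∈ P ×
    (∀ v → v ∈ P → WalkIn G (∁ S) u v) × (∀ {v w} → v ∈ P → v ~ w → w ∉ S → w ∈ P)
  reachable-set {u} u∉ = grow n ⁅ u ⁆ (ℕ.m≤m+n n _) (x∈⁅x⁆ u)
      λ v v∈ → subst (WalkIn G (∁ S) u) (≡-sym (x∈⁅y⁆⇒x≡y u v∈)) (here (x∉p⇒x∈∁p u∉))
    where
    grow : ∀ m P → n ≤ m + ∣ P ∣ → u ∈ P → (∀ v → v ∈ P → WalkIn G (∁ S) u v) →
      Σ (Subset n) λ P → u ∈ P ×
        (∀ v → v ∈ P → WalkIn G (∁ S) u v) × (∀ {v w} → v ∈ P → v ~ w → w ∉ S → w ∈ P)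
    grow m P n≤ u∈ reach
      with any? (λ w → ¬? (w ∈? P) ×-dec ¬? (w ∈? S) ×-dec any? λ v → (v ∈? P) ×-dec (v ~? w))
    ... | no closed = P , u∈ , reach , λ {v} {w} v∈ v~w w∉S →
      decidable-stable (w ∈? P) λ w∉P → closed (w , w∉P , w∉S , v , v∈ , v~w)
    ... | yes (w , w∉P , w∉S , v , v∈ , v~w) = continue m n≤
      where
      P⁺ = P ∪ ⁅ w ⁆
      w∈P⁺ : w ∈ P⁺
      w∈P⁺ = x∈p∪q⁺ (inj₂ (x∈⁅x⁆ w))
      ∣P∣<∣P⁺∣ : ∣ P ∣ < ∣ P⁺ ∣
      ∣P∣<∣P⁺∣ = p⊂q⇒∣p∣<∣q∣ (p⊆p∪q ⁅ w ⁆ , w , w∈P⁺ , w∉P)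
      reach⁺ : ∀ v′ → v′ ∈ P⁺ → WalkIn G (∁ S) u v′
      reach⁺ v′ v′∈ with x∈p∪q⁻ P ⁅ w ⁆ v′∈
      ... | inj₁ v′∈P = reach v′ v′∈P
      ... | inj₂ v′∈w = subst (WalkIn G (∁ S) u) (≡-sym (x∈⁅y⁆⇒x≡y w v′∈w))
        (walk-snoc (reach v v∈) v~w (x∉p⇒x∈∁p w∉S))
      continue : ∀ m → n ≤ m + ∣ P ∣ → _
      continue zero n≤ = contradiction (ℕ.≤-trans ∣P∣<∣P⁺∣ (∣p∣≤n P⁺)) (ℕ.≤⇒≯ n≤)
      continue (suc m) n≤ = grow m P⁺ (ℕ.≤-trans n≤ (ℕ.≤-trans (ℕ.≤-reflexive (≡-sym (ℕ.+-suc m ∣ P ∣)))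
        (ℕ.+-monoʳ-≤ m ∣P∣<∣P⁺∣))) (p⊆p∪q ⁅ w ⁆ u∈) reach⁺

  separating⇒Cut : Separating G S → ∃₂ λ A B → Cut G S A B
  separating⇒Cut (u , v , u∉ , v∉ , no-walk) with reachable-set u∉
  ... | P , u∈ , reach , closed = P ─ S , ∁ (S ∪ P) , record
    { cover = cover
    ; A∩S = x∈p─q⇒x∉q P S
    ; B∩S = λ b∈ b∈S → x∈∁p⇒x∉p b∈ (x∈p∪q⁺ (inj₁ b∈S))
    ; A∩B = λ a∈ a∈B → x∈∁p⇒x∉p a∈B (x∈p∪q⁺ (inj₂ (p─q⊆p P S a∈)))
    ; no-cross = λ a∈ b∈ a~b → x∈∁p⇒x∉p b∈ (x∈p∪q⁺ (inj₂
        (closed (p─q⊆p P S a∈) a~b λ b∈S → x∈∁p⇒x∉p b∈ (x∈p∪q⁺ (inj₁ b∈S)))))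
    ; A≢∅ = u , x∈p∧x∉q⇒x∈p─q u∈ u∉
    ; B≢∅ = v , x∉p⇒x∈∁p λ v∈ → [ v∉ , no-walk ∘ reach v ]′ (x∈p∪q⁻ S P v∈) }
    where
    cover : ∀ w → w ∈ S ⊎ w ∈ P ─ S ⊎ w ∈ ∁ (S ∪ P)
    cover w with w ∈? S | w ∈? P
    ... | yes w∈S | _ = inj₁ w∈S
    ... | no w∉S | yes w∈P = inj₂ (inj₁ (x∈p∧x∉q⇒x∈p─q w∈P w∉S))
    ... | no w∉S | no w∉P = inj₂ (inj₂ (x∉p⇒x∈∁p ([ w∉S , w∉P ]′ ∘ x∈p∪q⁻ S P)))

  -- A walk from `A` to `B` has to leave `A`, and no edge goes directly from `A` to `B`.
  side-meets-cut : ∀ {A B} → Connected G → Cut G S A B → ∃₂ λ a s → a ∈ A × s ∈ S × a ~ s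
  side-meets-cut (_ , walk) cut with Cut.A≢∅ cut | Cut.B≢∅ cut
  ... | a , a∈ | b , b∈ with walk-exit (walk a b ∈⊤ ∈⊤) a∈ (λ b∈A → Cut.A∩B cut b∈A b∈)
  ... | x , y , x∈ , y∉ , x~y with Cut.cover cut y
  ... | inj₁ y∈S = x , y , x∈ , y∈S , x~y
  ... | inj₂ (inj₁ y∈A) = contradiction y∈A y∉
  ... | inj₂ (inj₂ y∈B) = contradiction x~y (Cut.no-cross cut x∈ y∈B)

-- Arcs across a cut smaller than every degree

module Critical {n} (G : Graph n)
  (no-edge : ∀ {u v} → Domination._~_ G u v → ¬ Domination.DominatingPair G u v)
  (dichotomy : ∀ {u v} → u ≢ v → Domination._≁_ G u v → Domination.DominatingPair G u v ⊎
    (∃ λ y → Domination.Arc G u y v) ⊎ (∃ λ y → Domination.Arc G v y u))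
  (S : Subset n) (∣S∣<deg : ∀ v → ∣ S ∣ < degree G v) where

  open Domination G

  module _ {A B} (cut : Cut G S A B) where
    open Cut cut

    neighbour-in-side : ∀ {a} → a ∈ A → ∃ λ a′ → a′ ∈ A × a ~ a′
    neighbour-in-side {a} a∈ with neighbour-outside G S a (∣S∣<deg a)
    ... | w , a~w , w∉ with cover w
    ... | inj₁ w∈S = contradiction w∈S w∉
    ... | inj₂ (inj₁ w∈A) = w , w∈A , a~w
    ... | inj₂ (inj₂ w∈B) = contradiction a~w (no-cross a∈ w∈B)

    -- Missing `s` leaves `a` at most `∣ S ∣ - 1` neighbours in the cut, so the degree bound
    -- tolerates the exclusion of one more vertex `c`.
    other-neighbour-in-side : ∀ {a s} → a ∈ A → s ∈ S → a ≁ s → ∀ c →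
      ∃ λ a′ → a′ ∈ A × a ~ a′ × a′ ≢ c
    other-neighbour-in-side {a} {s} a∈ s∈ a≁s c with neighbour-outside G ((S - s) ∪ ⁅ c ⁆) a
      (ℕ.<-≤-trans (s≤s (ℕ.≤-trans (∣p∪⁅x⁆∣≤1+∣p∣ (S - s) c) (x∈p⇒∣p-x∣<∣p∣ s∈))) (∣S∣<deg a))
    ... | w , a~w , w∉ with cover w
    ... | inj₁ w∈S = contradiction (x∈p∪q⁺ (inj₁ (x∈p∧x≢y⇒x∈p-y w∈S λ { refl → a≁s a~w }))) w∉
    ... | inj₂ (inj₁ w∈A) = w , w∈A , a~w , λ { refl → w∉ (x∈p∪q⁺ (inj₂ (x∈⁅x⁆ w))) }
    ... | inj₂ (inj₂ w∈B) = contradiction a~w (no-cross a∈ w∈B)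

  module _ {A B} (cut : Cut G S A B) where
    open Cut cut

    member-of-B-≢ : ∀ v → ∃ λ b → b ∈ B × b ≢ v
    member-of-B-≢ v with B≢∅
    ... | b , b∈ with b ≟ v
    ... | no b≢v = b , b∈ , b≢v
    ... | yes refl with neighbour-in-side (cut-swap cut) b∈
    ... | b′ , b′∈ , b~b′ = b′ , b′∈ , ≢-sym (~⇒≢ b~b′)

    -- Since `a` dominates nothing in `B`, the vertex `y` must dominate all of `B` but `v`. As `B`
    -- has a vertex other than `v`, this keeps `y` out of `A`, and adjacency to `a` keeps it out of
    -- `B`.
    arc-across : ∀ {a y v} → a ∈ A → Arc a y v → y ∈ S × (∀ b → b ∈ B → b ≢ v → y ~ b)
    arc-across {a} {y} {v} a∈ t = y∈S , λ b b∈ b≢v → ⊵⇒~ (y⊵ b∈ b≢v) λ { refl → B∩S b∈ y∈S }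
      where
      y⊵ : ∀ {b} → b ∈ B → b ≢ v → y ⊵ b
      y⊵ b∈ b≢v with dominates t _ b≢v
      ... | inj₁ (inj₁ refl) = contradiction b∈ (A∩B a∈)
      ... | inj₁ (inj₂ a~b) = contradiction a~b (no-cross a∈ b∈)
      ... | inj₂ d = d
      y∈S : y ∈ S
      y∈S with cover y | member-of-B-≢ v
      ... | inj₁ y∈ | _ = y∈
      ... | inj₂ (inj₂ y∈B) | _ = contradiction (tail~ t) (no-cross a∈ y∈B)
      ... | inj₂ (inj₁ y∈A) | b , b∈ , b≢v with y⊵ b∈ b≢v
      ... | inj₁ refl = contradiction b∈ (A∩B y∈A)
      ... | inj₂ y~b = contradiction y~b (no-cross y∈A b∈)

  module _ {A B} (cut : Cut G S A B) where
    open Cut cut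

    arc-from-outside : ∀ {a y v} → a ∉ S → Arc a y v → y ∈ S
    arc-from-outside {a} a∉ t with cover a
    ... | inj₁ a∈ = contradiction a∈ a∉
    ... | inj₂ (inj₁ a∈) = proj₁ (arc-across cut a∈ t)
    ... | inj₂ (inj₂ a∈) = proj₁ (arc-across (cut-swap cut) a∈ t)

    cross : ∀ {a b} → a ∈ A → b ∈ B →
      DominatingPair a b ⊎ (∃ λ s → s ∈ S × Arc a s b) ⊎ (∃ λ s → s ∈ S × Arc b s a)
    cross a∈ b∈ with dichotomy (λ { refl → A∩B a∈ b∈ }) (no-cross a∈ b∈)
    ... | inj₁ d = inj₁ d
    ... | inj₂ (inj₁ (s , t)) = inj₂ (inj₁ (s , arc-from-outside (A∩S a∈) t , t))
    ... | inj₂ (inj₂ (s , t)) = inj₂ (inj₂ (s , arc-from-outside (B∩S b∈) t , t))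

    dominates-own-side : ∀ {a b a′} → a ∈ A → b ∈ B → DominatingPair a b → a′ ∈ A → a ⊵ a′
    dominates-own-side a∈ b∈ d a′∈ with d _
    ... | inj₁ e = e
    ... | inj₂ (inj₁ refl) = contradiction b∈ (A∩B a′∈)
    ... | inj₂ (inj₂ b~a′) = contradiction (~-sym b~a′) (no-cross a′∈ b∈)

    -- With `S` reduced to `s`, every arc across has witness `s`, so `a` and `b` form a dominating
    -- pair, and `s` cannot miss vertices on both sides. If `s` misses a vertex of `A`, it is
    -- complete to `B` and the edge `as` dominates; otherwise the edge `bs` does.
    no-cut-vertex : (∀ {s s′} → s ∈ S → s′ ∈ S → s ≡ s′) →
      ∀ {a b s} → a ∈ A → b ∈ B → s ∈ S → a ~ s → b ~ s → ⊥
    no-cut-vertex one {a} {b} {s} a∈ b∈ s∈ a~s b~s = no-edge b~s λ w →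
      [ inj₂ ∘ inj₁ ∘ flip one s∈
      , [ (λ a′∈ → inj₂ (inj₂ (s~A a′∈))) , (λ b′∈ → inj₁ (b⊵B b′∈)) ]′ ]′ (cover w)
      where
      ab : DominatingPair a b
      ab with cross a∈ b∈
      ... | inj₁ d = d
      ... | inj₂ (inj₁ (s′ , s′∈ , t)) with one s∈ s′∈
      ... | refl = contradiction (~-sym b~s) (head≁ t)
      ab | inj₂ (inj₂ (s′ , s′∈ , t)) with one s∈ s′∈
      ... | refl = contradiction (~-sym a~s) (head≁ t)
      both : ∀ {a′ b′} → a′ ∈ A → b′ ∈ B → s ≁ a′ → s ≁ b′ → ⊥
      both a′∈ b′∈ s≁a′ s≁b′ with cross a′∈ b′∈
      ... | inj₁ d = [ [ (λ { refl → A∩S a′∈ s∈ }) , s≁a′ ∘ ~-sym ]′ , [ (λ { refl → B∩S b′∈ s∈ }) , s≁b′ ∘ ~-sym ]′ ]′ (d s)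
      ... | inj₂ (inj₁ (s′ , s′∈ , t)) with one s∈ s′∈
      ... | refl = s≁a′ (~-sym (tail~ t))
      both a′∈ b′∈ s≁a′ s≁b′ | inj₂ (inj₂ (s′ , s′∈ , t)) with one s∈ s′∈
      ... | refl = s≁b′ (~-sym (tail~ t))
      b⊵B : ∀ {b′} → b′ ∈ B → b ⊵ b′
      b⊵B b′∈ with ab _
      ... | inj₂ e = e
      ... | inj₁ (inj₁ refl) = contradiction b′∈ (A∩B a∈)
      ... | inj₁ (inj₂ a~b′) = contradiction a~b′ (no-cross a∈ b′∈)
      s~A : ∀ {a′} → a′ ∈ A → s ~ a′
      s~A {a′} a′∈ with s ~? a′
      ... | yes e = e
      ... | no s≁a′ = ⊥-elim (no-edge a~s λ w →
        [ inj₂ ∘ inj₁ ∘ flip one s∈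
        , [ inj₁ ∘ dominates-own-side a∈ b∈ ab
          , (λ b′∈ → inj₂ (inj₂ (decidable-stable (s ~? w) (both a′∈ b′∈ s≁a′)))) ]′ ]′ (cover w))

  -- Recovering all edges from a labelled cut with two vertices

  module LabelledCut {A B} (cut : Cut G S A B) {a b x s u : Fin n}
    (a∈A : a ∈ A) (u∈A : u ∈ A) (b∈B : b ∈ B) (x∈S : x ∈ S) (s∈S : s ∈ S)
    (S⊆ : ∀ q → q ∈ S → q ≡ x ⊎ q ≡ s)
    (x≁a : x ≁ a) (x≁b : x ≁ b) (s~a : s ~ a) (s≁b : s ≁ b) (s~x : s ~ x)
    (s≁u : s ≁ u) (x~A : ∀ z → z ∈ A → z ≢ a → x ~ z) (s~B : ∀ z → z ∈ B → z ≢ b → s ~ z) where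

    open Cut cut

    private
      B⁻ = B - b

      ∈B⁻ : ∀ {z} → z ∈ B → z ≢ b → z ∈ B⁻
      ∈B⁻ = x∈p∧x≢y⇒x∈p-y

      B⁻⁻ : ∀ {z} → z ∈ B⁻ → z ∈ B × z ≢ b
      B⁻⁻ = x∈p-y⁻ B b

    u≢a : u ≢ a
    u≢a refl = s≁u s~a

    -- Neither `u` nor `b` dominates `s`, so an arc joins them. Its witness lies in `S` and is
    -- adjacent to the tail, which leaves only `x`, with tail `u`.
    arc-u-x-b : Arc u x b
    arc-u-x-b with cross cut u∈A b∈B
    ... | inj₁ d = contradiction (d s)
      [ (λ e → s≁u (~-sym (⊵⇒~ e λ { refl → A∩S u∈A s∈S })))
      , (λ e → s≁b (~-sym (⊵⇒~ e λ { refl → B∩S b∈B s∈S }))) ]′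
    ... | inj₂ (inj₁ (q , q∈ , t)) with S⊆ q q∈
    ... | inj₁ refl = t
    ... | inj₂ refl = contradiction (~-sym (tail~ t)) s≁u
    arc-u-x-b | inj₂ (inj₂ (q , q∈ , t)) with S⊆ q q∈
    ... | inj₁ refl = contradiction (~-sym (tail~ t)) x≁b
    ... | inj₂ refl = contradiction (~-sym (tail~ t)) s≁b

    x~B : ∀ z → z ∈ B → z ≢ b → x ~ z
    x~B = proj₂ (arc-across cut u∈A arc-u-x-b)

    -- If `s` missed both `u` and `z`, the dichotomy for `u` and `s` would fail. The vertex `b` must
    -- be dominated by the witness `q`, which forces an arc from `s` to `u` with `q` in `B`; then
    -- nothing dominates `z`.
    s~A : ∀ z → z ∈ A → z ≢ u → s ~ z
    s~A z z∈ z≢u = decidable-stable (s ~? z) unique-miss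
      where
      unique-miss : ¬ (s ≁ z)
      unique-miss s≁z with dichotomy {u} {s} (λ { refl → A∩S u∈A s∈S }) (s≁u ∘ ~-sym)
      ... | inj₁ d = [ (λ e → no-cross u∈A b∈B (⊵⇒~ e λ { refl → A∩B u∈A b∈B }))
                     , (λ e → s≁b (⊵⇒~ e λ { refl → B∩S b∈B s∈S })) ]′ (d b)
      ... | inj₂ (inj₁ (q , t)) with dominates t b (λ { refl → B∩S b∈B s∈S })
      ... | inj₁ e = no-cross u∈A b∈B (⊵⇒~ e λ { refl → A∩B u∈A b∈B })
      ... | inj₂ (inj₁ refl) = no-cross u∈A b∈B (tail~ t)
      ... | inj₂ (inj₂ q~b) with cover q
      ... | inj₂ (inj₁ q∈A) = no-cross q∈A b∈B q~b
      ... | inj₂ (inj₂ q∈B) = no-cross u∈A q∈B (tail~ t)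
      ... | inj₁ q∈S = [ (λ { refl → x≁b q~b }) , (λ { refl → s≁b q~b }) ]′ (S⊆ q q∈S)
      unique-miss s≁z | inj₂ (inj₂ (q , t)) with dominates t b (λ { refl → A∩B u∈A b∈B })
      ... | inj₁ e = s≁b (⊵⇒~ e λ { refl → B∩S b∈B s∈S })
      ... | inj₂ (inj₁ refl) = s≁b (tail~ t)
      ... | inj₂ (inj₂ q~b) with cover q | dominates t z z≢u
      ... | _ | inj₁ e = s≁z (⊵⇒~ e λ { refl → A∩S z∈ s∈S })
      ... | inj₂ (inj₁ q∈A) | _ = no-cross q∈A b∈B q~b
      ... | inj₁ q∈S | _ = [ (λ { refl → x≁b q~b }) , (λ { refl → s≁b q~b }) ]′ (S⊆ q q∈S)
      ... | inj₂ (inj₂ q∈B) | inj₂ e = no-cross z∈ q∈B (~-sym (⊵⇒~ e λ { refl → A∩B z∈ q∈B }))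

    -- Both `x` and `s` are adjacent to `z` and to `c`, so neither can miss the head of an arc
    -- between them.
    typical-pair : ∀ {z c} → z ∈ A → z ≢ a → z ≢ u → c ∈ B → c ≢ b → DominatingPair z c
    typical-pair {z} {c} z∈ z≢a z≢u c∈ c≢b with cross cut z∈ c∈
    ... | inj₁ d = d
    ... | inj₂ (inj₁ (q , q∈ , t)) = ⊥-elim
      ([ (λ { refl → head≁ t (x~B c c∈ c≢b) }) , (λ { refl → head≁ t (s~B c c∈ c≢b) }) ]′ (S⊆ q q∈))
    ... | inj₂ (inj₂ (q , q∈ , t)) = ⊥-elim
      ([ (λ { refl → head≁ t (x~A z z∈ z≢a) }) , (λ { refl → head≁ t (s~A z z∈ z≢u) }) ]′ (S⊆ q q∈))

    third-in-A : ∃ λ v → v ∈ A × v ≢ a × v ≢ u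
    third-in-A with other-neighbour-in-side cut u∈A s∈S (s≁u ∘ ~-sym) a
    ... | v , v∈ , u~v , v≢a = v , v∈ , v≢a , ≢-sym (~⇒≢ u~v)

    -- Each end of a typical pair dominates its own side. This settles every vertex of `B` but `b`,
    -- and two distinct vertices of `B` are not both `b`.
    B-complete : ∀ {c d} → c ∈ B → d ∈ B → c ≢ d → c ~ d
    B-complete {c} {d} c∈ d∈ c≢d with c ≟ b | third-in-A
    ... | no c≢b | v , v∈ , v≢a , v≢u =
      ⊵⇒~ (dominates-own-side (cut-swap cut) c∈ v∈ (swap ∘ typical-pair v∈ v≢a v≢u c∈ c≢b) d∈) (≢-sym c≢d)
    ... | yes refl | v , v∈ , v≢a , v≢u =
      ~-sym (⊵⇒~ (dominates-own-side (cut-swap cut) d∈ v∈ (swap ∘ typical-pair v∈ v≢a v≢u d∈ (≢-sym c≢d)) c∈) c≢d)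

    u~a : u ~ a
    u~a with dominates arc-u-x-b a (λ { refl → A∩B a∈A b∈B })
    ... | inj₁ e = ⊵⇒~ e (≢-sym u≢a)
    ... | inj₂ e = contradiction (⊵⇒~ e λ { refl → A∩S a∈A x∈S }) x≁a

    -- Typical pairs settle every pair in `A` except `a` with `u`, which is covered by `u~a`.
    A-complete : ∀ {c d} → c ∈ A → d ∈ A → c ≢ d → c ~ d
    A-complete {c} {d} c∈ d∈ c≢d = [ (λ e → ⊵⇒~ e (≢-sym c≢d)) , (λ e → ~-sym (⊵⇒~ e c≢d)) ]′
      (either (c ≟ a) (c ≟ u) (d ≟ a) (d ≟ u))
      where
      far = member-of-B-≢ cut b
      own : ∀ {z z′} → z ∈ A → z′ ∈ A → z ≢ a → z ≢ u → z ⊵ z′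
      own z∈ z′∈ z≢a z≢u = dominates-own-side cut z∈ (proj₁ (proj₂ far))
        (typical-pair z∈ z≢a z≢u (proj₁ (proj₂ far)) (proj₂ (proj₂ far))) z′∈
      either : Dec (c ≡ a) → Dec (c ≡ u) → Dec (d ≡ a) → Dec (d ≡ u) → c ⊵ d ⊎ d ⊵ c
      either (no p) (no q) _ _ = inj₁ (own c∈ d∈ p q)
      either _ _ (no p) (no q) = inj₂ (own d∈ c∈ p q)
      either (yes refl) _ (yes refl) _ = contradiction refl c≢d
      either (yes refl) _ _ (yes refl) = inj₂ (inj₂ u~a)
      either _ (yes refl) (yes refl) _ = inj₁ (inj₂ u~a)
      either _ (yes p) _ (yes q) = contradiction (trans p (≡-sym q)) c≢d

    x≢s : x ≢ s
    x≢s = ≢-sym (~⇒≢ s~x)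

    2≤∣S∣ : 2 ≤ ∣ S ∣
    2≤∣S∣ = ℕ.≤-trans (s≤s (ℕ.≤-trans (s≤s z≤n) (x∈p⇒∣p-x∣<∣p∣ (x∈p∧x≢y⇒x∈p-y s∈S (≢-sym x≢s))))) (x∈p⇒∣p-x∣<∣p∣ x∈S)

    b-neighbours : ∀ w → b ~ w → w ∈ B⁻
    b-neighbours w b~w with cover w
    ... | inj₁ w∈S = ⊥-elim ([ (λ { refl → x≁b (~-sym b~w) }) , (λ { refl → s≁b (~-sym b~w) }) ]′ (S⊆ w w∈S))
    ... | inj₂ (inj₁ w∈A) = contradiction (~-sym b~w) (no-cross w∈A b∈B)
    ... | inj₂ (inj₂ w∈B) = ∈B⁻ w∈B (≢-sym (~⇒≢ b~w))

    data Place (z : Fin n) : Set where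
      in-B⁻ : z ∈ B⁻ → Place z
      in-A : z ∈ A → Place z
      is-x : z ≡ x → Place z
      is-s : z ≡ s → Place z
      is-b : z ≡ b → Place z

    place : ∀ z → Place z
    place z with cover z | z ≟ b
    ... | inj₁ z∈S | _ = [ is-x , is-s ]′ (S⊆ z z∈S)
    ... | inj₂ (inj₁ z∈A) | _ = in-A z∈A
    ... | inj₂ (inj₂ z∈B) | yes e = is-b e
    ... | inj₂ (inj₂ z∈B) | no z≢b = in-B⁻ (∈B⁻ z∈B z≢b)

    inG233 : InG233 G
    inG233 = B⁻ , A , x , s , b , u , a
      -- All neighbours of `b` lie in `B⁻`, the set `J₁`, and its degree exceeds `∣ S ∣`, which is
      -- at least 2.
      , ℕ.≤-trans (s≤s 2≤∣S∣) (ℕ.≤-trans (∣S∣<deg b) (degree-≤ G B⁻ b b-neighbours))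
      , (let (v , v∈ , v≢a , v≢u) = third-in-A in three-distinct⇒3≤∣p∣ A a∈A u∈A v∈ u≢a v≢a v≢u)
      , u∈A , a∈A , u≢a
      , (λ z z∈ z∈A → A∩B z∈A (proj₁ (B⁻⁻ z∈)))
      , ((λ p → B∩S (proj₁ (B⁻⁻ p)) x∈S) , (λ p → A∩S p x∈S))
      , ((λ p → B∩S (proj₁ (B⁻⁻ p)) s∈S) , (λ p → A∩S p s∈S))
      , ((λ p → proj₂ (B⁻⁻ p) refl) , (λ p → A∩B p b∈B))
      , x≢s , (λ { refl → B∩S b∈B x∈S }) , (λ { refl → B∩S b∈B s∈S })
      , everywhere
      , λ p q → classify (place p) (place q) , [ realise , ~-sym ∘ realise ]′
      where
      everywhere : ∀ z → z ∈ B⁻ ⊎ z ∈ A ⊎ z ≡ x ⊎ z ≡ s ⊎ z ≡ b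
      everywhere z with place z
      ... | in-B⁻ p = inj₁ p
      ... | in-A p = inj₂ (inj₁ p)
      ... | is-x p = inj₂ (inj₂ (inj₁ p))
      ... | is-s p = inj₂ (inj₂ (inj₂ (inj₁ p)))
      ... | is-b p = inj₂ (inj₂ (inj₂ (inj₂ p)))

      -- The edge relation local to `InG233`, instantiated at the present labels.
      Edge : Fin n → Fin n → Set
      Edge p q =
          (p ∈ B⁻ × q ∈ B⁻ × p ≢ q)
        ⊎ (p ∈ A × q ∈ A × p ≢ q)
        ⊎ (p ≡ b × q ∈ B⁻)
        ⊎ (p ≡ s × (q ∈ B⁻ ⊎ (q ∈ A × q ≢ u) ⊎ q ≡ x))
        ⊎ (p ≡ x × (q ∈ B⁻ ⊎ (q ∈ A × q ≢ a) ⊎ q ≡ s))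

      realise : ∀ {p q} → Edge p q → p ~ q
      realise (inj₁ (p∈ , q∈ , p≢q)) = B-complete (proj₁ (B⁻⁻ p∈)) (proj₁ (B⁻⁻ q∈)) p≢q
      realise (inj₂ (inj₁ (p∈ , q∈ , p≢q))) = A-complete p∈ q∈ p≢q
      realise (inj₂ (inj₂ (inj₁ (refl , q∈)))) = B-complete b∈B (proj₁ (B⁻⁻ q∈)) (≢-sym (proj₂ (B⁻⁻ q∈)))
      realise (inj₂ (inj₂ (inj₂ (inj₁ (refl , inj₁ q∈))))) = s~B _ (proj₁ (B⁻⁻ q∈)) (proj₂ (B⁻⁻ q∈))
      realise (inj₂ (inj₂ (inj₂ (inj₁ (refl , inj₂ (inj₁ (q∈ , q≢))))))) = s~A _ q∈ q≢
      realise (inj₂ (inj₂ (inj₂ (inj₁ (refl , inj₂ (inj₂ refl)))))) = s~x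
      realise (inj₂ (inj₂ (inj₂ (inj₂ (refl , inj₁ q∈))))) = x~B _ (proj₁ (B⁻⁻ q∈)) (proj₂ (B⁻⁻ q∈))
      realise (inj₂ (inj₂ (inj₂ (inj₂ (refl , inj₂ (inj₁ (q∈ , q≢))))))) = x~A _ q∈ q≢
      realise (inj₂ (inj₂ (inj₂ (inj₂ (refl , inj₂ (inj₂ refl)))))) = ~-sym s~x

      from-x : ∀ {q} → Place q → x ~ q → Edge x q
      from-x (in-B⁻ q∈) e = inj₂ (inj₂ (inj₂ (inj₂ (refl , inj₁ q∈))))
      from-x (in-A q∈) e = inj₂ (inj₂ (inj₂ (inj₂ (refl , inj₂ (inj₁ (q∈ , λ { refl → x≁a e }))))))
      from-x (is-x refl) e = contradiction e ~-irrefl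
      from-x (is-s refl) e = inj₂ (inj₂ (inj₂ (inj₂ (refl , inj₂ (inj₂ refl)))))
      from-x (is-b refl) e = contradiction e x≁b

      from-s : ∀ {q} → Place q → s ~ q → Edge s q
      from-s (in-B⁻ q∈) e = inj₂ (inj₂ (inj₂ (inj₁ (refl , inj₁ q∈))))
      from-s (in-A q∈) e = inj₂ (inj₂ (inj₂ (inj₁ (refl , inj₂ (inj₁ (q∈ , λ { refl → s≁u e }))))))
      from-s (is-x refl) e = inj₂ (inj₂ (inj₂ (inj₁ (refl , inj₂ (inj₂ refl)))))
      from-s (is-s refl) e = contradiction e ~-irrefl
      from-s (is-b refl) e = contradiction e s≁b

      classify : ∀ {p q} → Place p → Place q → p ~ q → Edge p q ⊎ Edge q p
      classify (is-x refl) q e = inj₁ (from-x q e)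
      classify (is-s refl) q e = inj₁ (from-s q e)
      classify (is-b refl) _ e = inj₁ (inj₂ (inj₂ (inj₁ (refl , b-neighbours _ e))))
      classify p (is-x refl) e = inj₂ (from-x p (~-sym e))
      classify p (is-s refl) e = inj₂ (from-s p (~-sym e))
      classify _ (is-b refl) e = inj₂ (inj₂ (inj₂ (inj₁ (refl , b-neighbours _ (~-sym e)))))
      classify (in-B⁻ p) (in-B⁻ q) e = inj₁ (inj₁ (p , q , ~⇒≢ e))
      classify (in-A p) (in-A q) e = inj₁ (inj₂ (inj₁ (p , q , ~⇒≢ e)))
      classify (in-A p) (in-B⁻ q) e = contradiction e (no-cross p (proj₁ (B⁻⁻ q)))
      classify (in-B⁻ p) (in-A q) e = contradiction (~-sym e) (no-cross q (proj₁ (B⁻⁻ p)))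

  -- An independent set larger than the cut

  module LargeIndependentSet (I : Subset n) (I-indep : ∀ {u v} → u ∈ I → v ∈ I → u ≁ v)
    (3≤∣I∣ : 3 ≤ ∣ I ∣) (∣S∣<∣I∣ : ∣ S ∣ < ∣ I ∣) where

    arc-avoids : ∀ {u y v} → u ∈ I → Arc u y v → y ∉ I
    arc-avoids u∈ t y∈ = I-indep u∈ y∈ (tail~ t)

    arc-adjacent : ∀ {u y v w} → u ∈ I → Arc u y v → w ∈ I → w ≢ v → y ~ w
    arc-adjacent {u} {w = w} u∈ t w∈ w≢v with dominates t w w≢v
    ... | inj₁ (inj₁ refl) = ~-sym (tail~ t)
    ... | inj₁ (inj₂ u~w) = contradiction u~w (I-indep u∈ w∈)
    ... | inj₂ (inj₁ refl) = contradiction w∈ (arc-avoids u∈ t)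
    ... | inj₂ (inj₂ y~w) = y~w

    not-dominating : ∀ {u v w} → u ∈ I → v ∈ I → w ∈ I → w ≢ u → w ≢ v → ¬ DominatingPair u v
    not-dominating {w = w} u∈ v∈ w∈ w≢u w≢v d with d w
    ... | inj₁ e = I-indep u∈ w∈ (⊵⇒~ e w≢u)
    ... | inj₂ e = I-indep v∈ w∈ (⊵⇒~ e w≢v)

    -- A third vertex of `I` is dominated by neither `u` nor `v`, so the dichotomy leaves only arcs.
    tournament : ∀ {u v} → u ∈ I → v ∈ I → u ≢ v → (∃ λ y → Arc u y v) ⊎ (∃ λ y → Arc v y u)
    tournament {u} {v} u∈ v∈ u≢v with dichotomy u≢v (I-indep u∈ v∈) | third-element I 3≤∣I∣ u v
    ... | inj₂ t | _ = t
    ... | inj₁ d | w , w∈ , w≢u , w≢v = contradiction d (not-dominating u∈ v∈ w∈ w≢u w≢v)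

    -- A vertex of S ∩ I is matched to itself, any other vertex of I to a
    -- vertex of S which misses it and nothing else in I.
    Matched : Fin n → Fin n → Set
    Matched p q = (p ∈ S × q ≡ p) ⊎ (p ∉ S × q ∉ I × q ≁ p × (∀ w → w ∈ I → w ≢ p → q ~ w))

    -- Vertices matched to themselves use values in `I`, the others values outside `I`; a vertex
    -- that misses `p` and nothing else in `I` determines `p`.
    Matched-injective : ∀ P → P ⊆ I → Injective Matched P
    Matched-injective P P⊆I p p′ q p∈ p′∈ (inj₁ (_ , refl)) (inj₁ (_ , refl)) = refl
    Matched-injective P P⊆I p p′ q p∈ p′∈ (inj₁ (_ , refl)) (inj₂ (_ , q∉ , _)) = contradiction (P⊆I p∈) q∉
    Matched-injective P P⊆I p p′ q p∈ p′∈ (inj₂ (_ , q∉ , _)) (inj₁ (_ , refl)) = contradiction (P⊆I p′∈) q∉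
    Matched-injective P P⊆I p p′ q p∈ p′∈ (inj₂ (_ , _ , q≁p , _)) (inj₂ (_ , _ , _ , q~)) =
      decidable-stable (p ≟ p′) λ p≢p′ → q≁p (q~ p (P⊆I p∈) p≢p′)

    arc⇒Matched : ∀ {u y v} → u ∈ I → v ∉ S → Arc u y v → Matched v y
    arc⇒Matched u∈ v∉ t = inj₂ (v∉ , arc-avoids u∈ t , head≁ t , λ w → arc-adjacent u∈ t)

    -- A vertex left over by the matching, together with what the count gives: were `witnesses` or
    -- `witness-unique` to fail, the rest of `I` could be matched into `S` with a vertex to spare.
    record Source (a : Fin n) : Set where
      field
        a∈I : a ∈ I
        a∉S : a ∉ S
        no-arc-into : ∀ {b y} → b ∈ I → b ∉ S → ¬ Arc b y a
        witnesses : ∀ {s} → s ∈ S → s ∉ I → ∃ λ b → b ∈ I × b ∉ S × b ≢ a × Arc a s b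
        witness-unique : ∀ {s s′ b} → s ∈ S → s ∉ I → s′ ∈ S → s′ ∉ I → b ∈ I →
          s ≁ b → s′ ≁ b → s ≡ s′

    module _ {A B} (cut : Cut G S A B) where
      open Cut cut

      -- Tails are taken outside `S` because their witnesses then lie in `S`, where the matching
      -- needs them.
      ArcInto : Fin n → Set
      ArcInto a = ∃ λ b → b ∈ I × b ∉ S × ∃ λ y → Arc b y a

      ArcInto? : ∀ a → Dec (ArcInto a)
      ArcInto? a = any? λ b → (b ∈? I) ×-dec ¬? (b ∈? S) ×-dec any? λ y → Arc? b y a

      source-of : ∀ {a} → a ∈ I → a ∉ S → ¬ ArcInto a → Source a
      source-of {a} a∈I a∉S none = record
        { a∈I = a∈I ; a∉S = a∉S
        ; no-arc-into = λ b∈ b∉ t → none (_ , b∈ , b∉ , _ , t)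
        ; witnesses = witnesses ; witness-unique = witness-unique }
        where
        I⁻ = I - a
        I⁻⊆I : I⁻ ⊆ I
        I⁻⊆I = proj₁ ∘ x∈p-y⁻ I a
        too-few : ∀ {s} → s ∈ S → ¬ Total Matched I⁻ (S - s)
        too-few {s} s∈ tot = ℕ.<⇒≱ ∣S∣<∣I∣ (ℕ.≤-trans (∣p∣≤1+∣p-x∣ I a) (ℕ.≤-trans
          (s≤s (injective⇒∣p∣≤∣q∣ Matched I⁻ (S - s) tot (Matched-injective I⁻ I⁻⊆I))) (x∈p⇒∣p-x∣<∣p∣ s∈)))
        arc-to : ∀ {p} → p ∈ I⁻ → p ∉ S → ∃ λ y → y ∈ S × Arc a y p
        arc-to p∈ p∉ with x∈p-y⁻ I a p∈
        ... | p∈I , p≢a with tournament a∈I p∈I (≢-sym p≢a)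
        ... | inj₁ (y , t) = y , arc-from-outside cut a∉S t , t
        ... | inj₂ t = contradiction (_ , p∈I , p∉ , t) none
        witnesses : ∀ {s} → s ∈ S → s ∉ I → ∃ λ b → b ∈ I × b ∉ S × b ≢ a × Arc a s b
        witnesses {s} s∈ s∉ with any? (λ b → (b ∈? I) ×-dec ¬? (b ∈? S) ×-dec ¬? (b ≟ a) ×-dec Arc? a s b)
        ... | yes e = e
        ... | no ¬e = contradiction tot (too-few s∈)
          where
          -- If `s` witnesses no arc from `a` into `I` outside `S`, the matching given by the arcs
          -- out of `a` avoids `s`.
          tot : Total Matched I⁻ (S - s)
          tot p p∈ with p ∈? S
          ... | yes p∈S = p , x∈p∧x≢y⇒x∈p-y p∈S (λ { refl → s∉ (I⁻⊆I p∈) }) , inj₁ (p∈S , refl)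
          ... | no p∉S with arc-to p∈ p∉S
          ... | y , y∈ , t = y , x∈p∧x≢y⇒x∈p-y y∈ (λ { refl → ¬e (p , I⁻⊆I p∈ , p∉S , proj₂ (x∈p-y⁻ I a p∈) , t) })
                               , arc⇒Matched a∈I p∉S t
        missed-unique : ∀ {s b p} → s ∈ S → s ∉ I → b ∈ I → p ∈ I → s ≁ b → s ≁ p → b ≡ p
        missed-unique {s} {b} {p} s∈ s∉ b∈ p∈ s≁b s≁p with witnesses s∈ s∉
        ... | c , _ , _ , _ , t = trans (hit b∈ s≁b) (≡-sym (hit p∈ s≁p))
          where
          hit : ∀ {d} → d ∈ I → s ≁ d → d ≡ c
          hit {d} d∈ s≁d = decidable-stable (d ≟ c) λ d≢c → s≁d (arc-adjacent a∈I t d∈ d≢c)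
        witness-unique : ∀ {s s′ b} → s ∈ S → s ∉ I → s′ ∈ S → s′ ∉ I → b ∈ I →
          s ≁ b → s′ ≁ b → s ≡ s′
        witness-unique {s} {s′} {b} s∈ s∉ s′∈ s′∉ b∈ s≁b s′≁b = decidable-stable (s ≟ s′) λ s≢s′ →
          too-few s′∈ (tot s≢s′)
          where
          tot : s ≢ s′ → Total Matched I⁻ (S - s′)
          tot s≢s′ p p∈ with p ∈? S
          ... | yes p∈S = p , x∈p∧x≢y⇒x∈p-y p∈S (λ { refl → s′∉ (I⁻⊆I p∈) }) , inj₁ (p∈S , refl)
          ... | no p∉S with arc-to p∈ p∉S
          ... | y , y∈ , t with y ≟ s′
          ... | no y≢s′ = y , x∈p∧x≢y⇒x∈p-y y∈ y≢s′ , arc⇒Matched a∈I p∉S t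
          -- The vertex `s′` can be matched only to `b`, so `p` is `b`. As `s` misses `b` too, it
          -- takes over and `s′` is spared.
          ... | yes refl with missed-unique s′∈ s′∉ b∈ (I⁻⊆I p∈) s′≁b (head≁ t)
          ... | refl = s , x∈p∧x≢y⇒x∈p-y s∈ s≢s′ , inj₂ (p∉S , s∉ , s≁b ,
            λ w w∈ w≢p → decidable-stable (s ~? w) λ s≁w → w≢p (missed-unique s∈ s∉ w∈ b∈ s≁w s≁b))

      -- Otherwise every vertex of `I` outside `S` is the head of an arc with witness in `S`, and
      -- all of `I` is matched into `S`.
      source-exists : ∃ Source
      source-exists with any? (λ a → (a ∈? I) ×-dec ¬? (a ∈? S) ×-dec ¬? (ArcInto? a))
      ... | yes (a , a∈ , a∉ , none) = a , source-of a∈ a∉ none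
      ... | no ¬e = contradiction
        (injective⇒∣p∣≤∣q∣ Matched I S tot (Matched-injective I id)) (ℕ.<⇒≱ ∣S∣<∣I∣)
        where
        tot : Total Matched I S
        tot p p∈ with p ∈? S
        ... | yes p∈S = p , p∈S , inj₁ (p∈S , refl)
        ... | no p∉S with ArcInto? p
        ... | no none = contradiction (p , p∈ , p∉S , none) ¬e
        ... | yes (b , b∈ , b∉ , y , t) = y , arc-from-outside cut b∉ t , arc⇒Matched b∈ p∉S t

    -- Locating the independent set relative to a source in `A`

    module _ {A B} (cut : Cut G S A B) {a₁} (src : Source a₁) (a₁∈A : a₁ ∈ A) where
      open Cut cut
      open Source src renaming (a∈I to a₁∈I; a∉S to a₁∉S)

      Target : Fin n → Set
      Target b = b ∈ I × b ∉ S × b ≢ a₁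

      arc-to-Target : ∀ {b} → Target b → ∃ λ s → s ∈ S × Arc a₁ s b
      arc-to-Target (b∈I , b∉S , b≢a₁) with tournament a₁∈I b∈I (≢-sym b≢a₁)
      ... | inj₁ (s , t) = s , arc-from-outside cut a₁∉S t , t
      ... | inj₂ (s , t) = contradiction t (no-arc-into b∈I b∉S)

      -- A vertex of `S` outside `I` is adjacent to `a₁`, and the one vertex of `I` it misses is
      -- outside `S`. The latter rules out an arc from `a₁` into `x`, the former a witness `y` in
      -- `S`.
      arc-from-S∩I : ∀ {x} → x ∈ I → x ∈ S → ∃ λ y → Arc x y a₁ × y ∉ S
      arc-from-S∩I {x} x∈I x∈S with tournament a₁∈I x∈I (λ { refl → a₁∉S x∈S })
      ... | inj₁ (s , t) with witnesses (arc-from-outside cut a₁∉S t) (arc-avoids a₁∈I t)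
      ... | b , _ , b∉S , _ , t′ = contradiction
        (arc-adjacent a₁∈I t′ x∈I λ { refl → b∉S x∈S }) (head≁ t)
      arc-from-S∩I {x} x∈I x∈S | inj₂ (y , t) = y , t , λ y∈S → impossible (witnesses y∈S (arc-avoids x∈I t))
        where
        impossible : ¬ (∃ λ b → b ∈ I × b ∉ S × b ≢ a₁ × Arc a₁ y b)
        impossible (_ , _ , _ , _ , t′) = head≁ t (~-sym (tail~ t′))

      -- If `I` avoids `S`, a vertex `v` of `B` outside `I` is complete to `S` and forms a
      -- dominating pair with `a₁`. The rest of `I` then lies in `B`, and the witness of an arc
      -- between two of its vertices is complete to `A`, so it forms a dominating edge with `v`.
      I-meets-S : ∃ λ x → x ∈ I × x ∈ S
      I-meets-S with any? (λ x → (x ∈? I) ×-dec (x ∈? S))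
      ... | yes e = e
      ... | no disjoint = ⊥-elim absurd
        where
        witness : ∀ {s} → s ∈ S → ∃ λ b → b ∈ I × b ∉ S × b ≢ a₁ × Arc a₁ s b
        witness {s} s∈ = witnesses s∈ λ s∈I → disjoint (s , s∈I , s∈)
        B∖I : ∃ λ v → v ∈ B × v ∉ I
        B∖I with B≢∅
        ... | b , b∈ with b ∈? I
        ... | no b∉ = b , b∈ , b∉
        ... | yes b∈I with neighbour-in-side (cut-swap cut) b∈
        ... | b′ , b′∈ , b~b′ = b′ , b′∈ , λ b′∈I → I-indep b∈I b′∈I b~b′
        absurd : ⊥
        absurd with B∖I
        ... | v , v∈B , v∉I = conclude (third-element I 3≤∣I∣ a₁ a₁)
          where
          v~S : ∀ {s} → s ∈ S → v ~ s
          v~S s∈ with witness s∈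
          ... | b , b∈I , _ , _ , t = ~-sym (proj₂ (arc-across cut a₁∈A t) v v∈B λ { refl → v∉I b∈I })
          d : DominatingPair a₁ v
          d with cross cut a₁∈A v∈B
          ... | inj₁ d = d
          ... | inj₂ (inj₁ (s , s∈ , t)) = contradiction (~-sym (v~S s∈)) (head≁ t)
          ... | inj₂ (inj₂ (s , s∈ , t)) with witness s∈
          ... | _ , _ , _ , _ , t′ = contradiction (~-sym (tail~ t′)) (head≁ t)
          in-B : ∀ {p} → p ∈ I → p ≢ a₁ → p ∈ B
          in-B {p} p∈ p≢ with d p | cover p
          ... | inj₁ e | _ = contradiction (⊵⇒~ e p≢) (I-indep a₁∈I p∈)
          ... | inj₂ e | inj₁ p∈S = contradiction (p , p∈ , p∈S) disjoint
          ... | inj₂ e | inj₂ (inj₂ p∈B) = p∈B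
          ... | inj₂ e | inj₂ (inj₁ p∈A) =
            contradiction (~-sym (⊵⇒~ e λ { refl → v∉I p∈ })) (no-cross p∈A v∈B)
          no-arc : ∀ {b s b′} → b ∈ B → b′ ∈ B → ¬ Arc b s b′
          no-arc b∈ b′∈ t with arc-across (cut-swap cut) b∈ t
          ... | s∈ , s~A = no-edge (v~S s∈) λ w →
            [ inj₁ ∘ inj₂ ∘ v~S
            , [ (λ w∈A → inj₂ (inj₂ (s~A w w∈A λ { refl → A∩B w∈A b′∈ })))
              , inj₁ ∘ dominates-own-side (cut-swap cut) v∈B a₁∈A (swap ∘ d) ]′ ]′ (cover w)
          conclude : (∃ λ b → b ∈ I × b ≢ a₁ × b ≢ a₁) → ⊥
          conclude (b , b∈I , b≢a₁ , _) with third-element I 3≤∣I∣ a₁ b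
          ... | b′ , b′∈I , b′≢a₁ , b′≢b =
            [ no-arc (in-B b∈I b≢a₁) (in-B b′∈I b′≢a₁) ∘ proj₂
            , no-arc (in-B b′∈I b′≢a₁) (in-B b∈I b≢a₁) ∘ proj₂ ]′ (tournament b∈I b′∈I (≢-sym b′≢b))

      -- The witness `y`, being in `B`, dominates nothing in `A`, so `x` has to. The next lemma
      -- treats the other side.
      S∩I~A : ∀ {x y z} → x ∈ S → Arc x y a₁ → y ∈ B → z ∈ A → z ≢ a₁ → x ~ z
      S∩I~A x∈S t y∈B z∈A z≢a₁ with dominates t _ z≢a₁
      ... | inj₁ e = ⊵⇒~ e λ { refl → A∩S z∈A x∈S }
      ... | inj₂ e = contradiction (~-sym (⊵⇒~ e λ { refl → A∩B z∈A y∈B })) (no-cross z∈A y∈B)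

      S∩I~B : ∀ {x y z} → x ∈ S → Arc x y a₁ → y ∈ A → z ∈ B → x ~ z
      S∩I~B x∈S t y∈A z∈B with dominates t _ (λ { refl → A∩B a₁∈A z∈B })
      ... | inj₁ e = ⊵⇒~ e λ { refl → B∩S z∈B x∈S }
      ... | inj₂ e = contradiction (⊵⇒~ e λ { refl → A∩B y∈A z∈B }) (no-cross y∈A z∈B)

      module _ {x₀} (x₀∈I : x₀ ∈ I) (x₀∈S : x₀ ∈ S) where

        -- Without targets `S` lies in `I`. Then `S` is complete to `B`, and `a₁` is adjacent to all
        -- the rest of `A`, to which `S` is complete as well. The witness of an arc inside `S` is a
        -- neighbour of `a₁` in `A`, hence adjacent to the head.
        Target-exists : ∃ Target
        Target-exists with any? (λ b → (b ∈? I) ×-dec ¬? (b ∈? S) ×-dec ¬? (b ≟ a₁))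
        ... | yes e = e
        ... | no none = ⊥-elim absurd
          where
          S⊆I : S ⊆ I
          S⊆I {s} s∈ = decidable-stable (s ∈? I) λ s∉ →
            let (b , b∈ , b∉ , b≢ , _) = witnesses s∈ s∉ in none (b , b∈ , b∉ , b≢)
          a₁≁S : ∀ {s} → s ∈ S → a₁ ≁ s
          a₁≁S s∈ = I-indep a₁∈I (S⊆I s∈)
          B~S : ∀ {b s} → b ∈ B → s ∈ S → b ~ s
          B~S {b} {s} b∈ s∈ with cross cut a₁∈A b∈
          ... | inj₁ d = [ (λ e → contradiction (⊵⇒~ e λ { refl → a₁∉S s∈ }) (a₁≁S s∈))
                         , (λ e → ⊵⇒~ e λ { refl → B∩S b∈ s∈ }) ]′ (d s)
          ... | inj₂ (inj₁ (s′ , s′∈ , t)) = contradiction (tail~ t) (a₁≁S s′∈)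
          ... | inj₂ (inj₂ (s′ , s′∈ , t)) with dominates t s (λ { refl → a₁∉S s∈ })
          ... | inj₁ e = ⊵⇒~ e λ { refl → B∩S b∈ s∈ }
          ... | inj₂ (inj₁ refl) = tail~ t
          ... | inj₂ (inj₂ s′~s) = contradiction s′~s (I-indep (S⊆I s′∈) (S⊆I s∈))
          A~a₁ : ∀ {z} → z ∈ A → z ≢ a₁ → z ~ a₁
          A~a₁ z∈ z≢a₁ with B≢∅
          ... | b , b∈ with cross cut z∈ b∈
          ... | inj₁ d = ⊵⇒~ (dominates-own-side cut z∈ b∈ d a₁∈A) (≢-sym z≢a₁)
          ... | inj₂ (inj₁ (s , s∈ , t)) = contradiction (~-sym (B~S b∈ s∈)) (head≁ t)
          ... | inj₂ (inj₂ (s , s∈ , t)) = contradiction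
            (~-sym (proj₂ (arc-across (cut-swap cut) b∈ t) a₁ a₁∈A (≢-sym z≢a₁))) (a₁≁S s∈)
          S~A : ∀ {x z} → x ∈ S → z ∈ A → z ≢ a₁ → x ~ z
          S~A x∈ z∈ z≢a₁ with arc-from-S∩I (S⊆I x∈) x∈
          ... | y , t , y∉S with cover y
          ... | inj₁ y∈S = contradiction y∈S y∉S
          ... | inj₂ (inj₂ y∈B) = S∩I~A x∈ t y∈B z∈ z≢a₁
          ... | inj₂ (inj₁ y∈A) = contradiction
            (A~a₁ y∈A λ { refl → a₁≁S x∈ (~-sym (tail~ t)) }) (head≁ t)
          no-arc : ∀ {x p x′} → x ∈ S → x′ ∈ S → ¬ Arc x p x′
          no-arc {x} {p} {x′} x∈ x′∈ t with cover p | arc-adjacent (S⊆I x∈) t a₁∈I (λ { refl → a₁∉S x′∈ })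
          ... | inj₁ p∈S | _ = arc-avoids (S⊆I x∈) t (S⊆I p∈S)
          ... | inj₂ (inj₁ p∈A) | p~a₁ = head≁ t (~-sym (S~A x′∈ p∈A (~⇒≢ p~a₁)))
          ... | inj₂ (inj₂ p∈B) | p~a₁ = no-cross a₁∈A p∈B (~-sym p~a₁)
          absurd : ⊥
          absurd with third-element I 3≤∣I∣ a₁ x₀
          ... | x′ , x′∈I , x′≢a₁ , x′≢x = [ no-arc x₀∈S x′∈S ∘ proj₂ , no-arc x′∈S x₀∈S ∘ proj₂ ]′
              (tournament x₀∈I x′∈I (≢-sym x′≢x))
            where
            x′∈S : x′ ∈ S
            x′∈S = decidable-stable (x′ ∈? S) λ x′∉S → none (x′ , x′∈I , x′∉S , x′≢a₁)

        -- A target `b` in `A` draws the witnesses of arcs from `S ∩ I` into `a₁` to `A`, so no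
        -- target lies in `B` and `S` is complete to `B`. Now take any vertex of `B` with `a₁`: a
        -- dominating pair would make `a₁` adjacent to `b`, and no arc is possible.
        Target⇒∉A : ∀ {b} → Target b → b ∉ A
        Target⇒∉A {b} (b∈I , b∉S , b≢a₁) b∈A = absurd
          where
          S∩I-arc-in-A : ∀ {x} → x ∈ I → x ∈ S → ∃ λ y → Arc x y a₁ × y ∈ A
          S∩I-arc-in-A x∈I x∈S with arc-from-S∩I x∈I x∈S
          ... | y , t , y∉S with cover y
          ... | inj₁ y∈S = contradiction y∈S y∉S
          ... | inj₂ (inj₁ y∈A) = y , t , y∈A
          ... | inj₂ (inj₂ y∈B) = contradiction (~-sym (arc-adjacent x∈I t b∈I b≢a₁)) (no-cross b∈A y∈B)
          Target∉B : ∀ {c} → Target c → c ∉ B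
          Target∉B (c∈I , _ , c≢a₁) c∈B with S∩I-arc-in-A x₀∈I x₀∈S
          ... | y , t , y∈A = no-cross y∈A c∈B (arc-adjacent x₀∈I t c∈I c≢a₁)
          S~B : ∀ {s β} → s ∈ S → β ∈ B → s ~ β
          S~B {s} s∈ β∈ with s ∈? I
          ... | yes s∈I with S∩I-arc-in-A s∈I s∈
          ... | y , t , y∈A = S∩I~B s∈ t y∈A β∈
          S~B {s} s∈ β∈ | no s∉I with witnesses s∈ s∉I
          ... | c , c∈I , c∉S , c≢a₁ , t =
            proj₂ (arc-across cut a₁∈A t) _ β∈ λ { refl → Target∉B (c∈I , c∉S , c≢a₁) β∈ }
          absurd : ⊥
          absurd with B≢∅
          ... | β , β∈ with cross cut a₁∈A β∈
          ... | inj₁ d = I-indep a₁∈I b∈I (⊵⇒~ (dominates-own-side cut a₁∈A β∈ d b∈A) b≢a₁)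
          ... | inj₂ (inj₁ (s , s∈ , t)) = head≁ t (S~B s∈ β∈)
          ... | inj₂ (inj₂ (s , s∈ , t)) with s ∈? I
          ... | yes s∈I = I-indep s∈I b∈I (proj₂ (arc-across (cut-swap cut) β∈ t) b b∈A b≢a₁)
          ... | no s∉I with witnesses s∈ s∉I
          ... | _ , _ , _ , _ , t′ = head≁ t (~-sym (tail~ t′))

        Target⇒∈B : ∀ {b} → Target b → b ∈ B
        Target⇒∈B {b} τ@(_ , b∉S , _) with cover b
        ... | inj₁ b∈S = contradiction b∈S b∉S
        ... | inj₂ (inj₁ b∈A) = contradiction b∈A (Target⇒∉A τ)
        ... | inj₂ (inj₂ b∈B) = b∈B

        module _ {b₀} (τ₀ : Target b₀) where

          S∩I-arc-in-B : ∀ {x} → x ∈ I → x ∈ S → ∃ λ y → Arc x y a₁ × y ∈ B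
          S∩I-arc-in-B x∈I x∈S with arc-from-S∩I x∈I x∈S
          ... | y , t , y∉S with cover y
          ... | inj₁ y∈S = contradiction y∈S y∉S
          ... | inj₂ (inj₁ y∈A) = contradiction
            (arc-adjacent x∈I t (proj₁ τ₀) (proj₂ (proj₂ τ₀))) (no-cross y∈A (Target⇒∈B τ₀))
          ... | inj₂ (inj₂ y∈B) = y , t , y∈B

          S∩I~A⁻ : ∀ {x z} → x ∈ I → x ∈ S → z ∈ A → z ≢ a₁ → x ~ z
          S∩I~A⁻ x∈I x∈S with S∩I-arc-in-B x∈I x∈S
          ... | y , t , y∈B = S∩I~A x∈S t y∈B

          module _ {y₀} (arc-y₀ : Arc x₀ y₀ a₁) (y₀∈B : y₀ ∈ B) where

            -- As a witness, `y₀` is adjacent to all of `I` but `a₁`. A vertex of `S` outside `I` is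
            -- complete to `B` up to a head in `I`, and `y₀` is not in `I`.
            y₀~S : ∀ {s} → s ∈ S → y₀ ~ s
            y₀~S {s} s∈ with s ∈? I
            ... | yes s∈I = arc-adjacent x₀∈I arc-y₀ s∈I λ { refl → a₁∉S s∈ }
            ... | no s∉I with witnesses s∈ s∉I
            ... | c , c∈I , _ , _ , t = ~-sym (proj₂ (arc-across cut a₁∈A t) y₀ y₀∈B
              λ e → arc-avoids x₀∈I arc-y₀ (subst (_∈ I) (≡-sym e) c∈I))

            -- If `y₀` forms a dominating pair with some vertex of `A` other than `a₁`, it dominates
            -- its own side. Failing this, two vertices `v` and `v′` of `A` are heads of arcs from
            -- `y₀` with witnesses `s₁` and `s₂` outside `I`. The targets these witnesses miss are
            -- compared: distinct ones carry an arc whose witness cannot exist, equal ones force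
            -- `s₁ ≡ s₂`, which misses only `v` in `A`.
            y₀⊵B : ∀ {z} → z ∈ B → y₀ ⊵ z
            y₀⊵B {z} z∈ with neighbour-in-side cut a₁∈A
            ... | v , v∈ , a₁~v = conclude (from v∈ (≢-sym (~⇒≢ a₁~v)))
              where
              Bad : Fin n → Set
              Bad v = ∃ λ s → s ∈ S × s ∉ I × Arc y₀ s v
              from : ∀ {v} → v ∈ A → v ≢ a₁ → y₀ ⊵ z ⊎ Bad v
              from v∈ v≢a₁ with cross cut v∈ y₀∈B
              ... | inj₁ d = inj₁ (dominates-own-side (cut-swap cut) y₀∈B v∈ (swap ∘ d) z∈)
              ... | inj₂ (inj₁ (s , s∈ , t)) = contradiction (~-sym (y₀~S s∈)) (head≁ t)
              ... | inj₂ (inj₂ (s , s∈ , t)) = inj₂ (s , s∈ , (λ s∈I → head≁ t (S∩I~A⁻ s∈I s∈ v∈ v≢a₁)) , t)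
              -- A witness s of an arc between targets is complete to A, so that s
              -- cannot be the vertex of S missing the head of this arc.
              no-arc : ∀ {p s q s′ v} → Target p → Target q → v ∈ A →
                s′ ∈ S → s′ ∉ I → s′ ≁ q → s′ ≁ v → ¬ Arc p s q
              no-arc τ@(p∈I , p∉S , _) υ@(q∈I , _) v∈ s′∈ s′∉ s′≁q s′≁v t
                with arc-across (cut-swap cut) (Target⇒∈B τ) t
              ... | s∈ , s~A with witness-unique s∈ (arc-avoids p∈I t) s′∈ s′∉ q∈I (head≁ t) s′≁q
              ... | refl = s′≁v (s~A _ v∈ λ { refl → A∩B v∈ (Target⇒∈B υ) })
              conclude : y₀ ⊵ z ⊎ Bad v → y₀ ⊵ z
              conclude (inj₁ e) = e
              conclude (inj₂ (s₁ , s₁∈ , s₁∉ , t₁)) with other-neighbour-in-side cut v∈ s₁∈ (head≁ t₁ ∘ ~-sym) a₁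
              ... | v′ , v′∈ , v~v′ , v′≢a₁ with from v′∈ v′≢a₁
              ... | inj₁ e = e
              ... | inj₂ (s₂ , s₂∈ , s₂∉ , t₂) with witnesses s₁∈ s₁∉ | witnesses s₂∈ s₂∉
              ... | b₁ , b₁∈I , b₁∉S , b₁≢a₁ , e₁ | b₂ , b₂∈I , b₂∉S , b₂≢a₁ , e₂ with b₁ ≟ b₂
              ... | no b₁≢b₂ = ⊥-elim ([ no-arc τ₁ τ₂ v′∈ s₂∈ s₂∉ (head≁ e₂) (head≁ t₂) ∘ proj₂
                                       , no-arc τ₂ τ₁ v∈ s₁∈ s₁∉ (head≁ e₁) (head≁ t₁) ∘ proj₂ ]′
                                       (tournament b₁∈I b₂∈I b₁≢b₂))
                where
                τ₁ = b₁∈I , b₁∉S , b₁≢a₁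
                τ₂ = b₂∈I , b₂∉S , b₂≢a₁
              ... | yes refl with witness-unique s₁∈ s₁∉ s₂∈ s₂∉ b₁∈I (head≁ e₁) (head≁ e₂)
              ... | refl = contradiction
                (proj₂ (arc-across (cut-swap cut) y₀∈B t₁) v′ v′∈ (≢-sym (~⇒≢ v~v′))) (head≁ t₂)

            -- The witness of an arc between two targets is complete to `A`, and `y₀` dominates `S`
            -- and `B`, so the two would form a dominating edge.
            Target-unique : ∀ {b b′} → Target b → Target b′ → b ≡ b′
            Target-unique {b} {b′} τ τ′ = decidable-stable (b ≟ b′) λ b≢b′ →
              [ no-arc τ τ′ ∘ proj₂ , no-arc τ′ τ ∘ proj₂ ]′ (tournament (proj₁ τ) (proj₁ τ′) b≢b′)
              where
              no-arc : ∀ {p s q} → Target p → Target q → ¬ Arc p s q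
              no-arc τ υ t with arc-across (cut-swap cut) (Target⇒∈B τ) t
              ... | s∈ , s~A = no-edge (y₀~S s∈) λ w →
                [ inj₁ ∘ inj₂ ∘ y₀~S
                , [ (λ w∈A → inj₂ (inj₂ (s~A w w∈A λ { refl → A∩B w∈A (Target⇒∈B υ) }))) , inj₁ ∘ y₀⊵B ]′ ]′ (cover w)

            -- The witness `p` of an arc inside `S ∩ I` has no place: in `S` it would miss a target
            -- that it must be adjacent to, in `A` it would be adjacent to `b₀`, and in `B` to `a₁`.
            S∩I-unique : ∀ {x x′} → x ∈ I → x ∈ S → x′ ∈ I → x′ ∈ S → x ≡ x′
            S∩I-unique {x} {x′} x∈I x∈S x′∈I x′∈S = decidable-stable (x ≟ x′) λ x≢x′ →
              [ no-arc x∈I x′∈S ∘ proj₂ , no-arc x′∈I x∈S ∘ proj₂ ]′ (tournament x∈I x′∈I x≢x′)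
              where
              no-arc : ∀ {x p x′} → x ∈ I → x′ ∈ S → ¬ Arc x p x′
              no-arc {x} {p} {x′} x∈I x′∈S t with cover p
              ... | inj₁ p∈S with witnesses p∈S (arc-avoids x∈I t)
              ... | c , c∈I , c∉S , _ , e = head≁ e (arc-adjacent x∈I t c∈I λ { refl → c∉S x′∈S })
              no-arc {x} {p} {x′} x∈I x′∈S t | inj₂ (inj₁ p∈A) =
                no-cross p∈A (Target⇒∈B τ₀) (arc-adjacent x∈I t (proj₁ τ₀) λ { refl → proj₁ (proj₂ τ₀) x′∈S })
              no-arc {x} {p} {x′} x∈I x′∈S t | inj₂ (inj₂ p∈B) =
                no-cross a₁∈A p∈B (~-sym (arc-adjacent x∈I t a₁∈I λ { refl → a₁∉S x′∈S }))

            InG233-from-target : InG233 G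
            InG233-from-target with arc-to-Target τ₀
            ... | s , s∈S , t with any? (λ u → (u ∈? A) ×-dec ¬? (s ~? u))
            -- Were `s` complete to `A`, its edge to `y₀` would dominate.
            ... | no none = ⊥-elim (no-edge (y₀~S s∈S) λ w →
              [ inj₁ ∘ inj₂ ∘ y₀~S
              , [ (λ w∈A → inj₂ (inj₂ (decidable-stable (s ~? w) λ s≁w → none (w , w∈A , s≁w))))
                , inj₁ ∘ y₀⊵B ]′ ]′ (cover w))
            ... | yes (u , u∈A , s≁u) = LabelledCut.inG233 cut a₁∈A u∈A (Target⇒∈B τ₀) x₀∈S s∈S S⊆
                (I-indep x₀∈I a₁∈I) (I-indep x₀∈I (proj₁ τ₀)) (~-sym (tail~ t)) (head≁ t)
                (arc-adjacent a₁∈I t x₀∈I λ e → proj₁ (proj₂ τ₀) (subst (_∈ S) e x₀∈S)) s≁u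
                (λ _ → S∩I~A⁻ x₀∈I x₀∈S) (proj₂ (arc-across cut a₁∈A t))
              where
              -- A vertex of `S` outside `I` misses a target, necessarily `b₀`, and only one such
              -- vertex misses `b₀`.
              S⊆ : ∀ q → q ∈ S → q ≡ x₀ ⊎ q ≡ s
              S⊆ q q∈ with q ∈? I
              ... | yes q∈I = inj₁ (S∩I-unique q∈I q∈ x₀∈I x₀∈S)
              ... | no q∉I with witnesses q∈ q∉I
              ... | c , c∈I , c∉S , c≢a₁ , e with Target-unique (c∈I , c∉S , c≢a₁) τ₀
              ... | refl = inj₂ (witness-unique q∈ q∉I s∈S (arc-avoids a₁∈I t) (proj₁ τ₀) (head≁ e) (head≁ t))

      source-in-A⇒InG233 : InG233 G
      source-in-A⇒InG233 with I-meets-S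
      ... | x , x∈I , x∈S with Target-exists x∈I x∈S
      ... | b , τ with S∩I-arc-in-B x∈I x∈S τ x∈I x∈S
      ... | y , t , y∈B = InG233-from-target x∈I x∈S τ t y∈B

    large-independent-set⇒InG233 : ∀ {A B} → Cut G S A B → InG233 G
    large-independent-set⇒InG233 cut with source-exists cut
    ... | a , src with Cut.cover cut a
    ... | inj₁ a∈S = contradiction a∈S (Source.a∉S src)
    ... | inj₂ (inj₁ a∈A) = source-in-A⇒InG233 cut src a∈A
    ... | inj₂ (inj₂ a∈B) = source-in-A⇒InG233 (cut-swap cut) src a∈B

-- Deciding between the two conclusions

independent-exceeding? : ∀ {n} (G : Graph n) k → Dec (∃ λ I → k < ∣ I ∣ × Independent G I)
independent-exceeding? G k = anySubset? λ I → (k ℕ.<? ∣ I ∣) ×-dec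
  all? λ u → all? λ v → map′ (λ f u∈ v∈ → f (u∈ , v∈)) (λ f p → f (proj₁ p) (proj₂ p))
    (((u ∈? I) ×-dec (v ∈? I)) →-dec (adj G u v ≟ᵇ false))

theorem4p1 : ∀ {n} (G : Graph n) (k d : ℕ) →
    Connected G → ThreeGammaCCritical G →
    MinDegree G d → 2 ≤ d →
    Connectivity G k → k + 1 ≤ d →
    IndependenceAtMost G k ⊎ InG233 G
theorem4p1 G k d conn crit (_ , d≤) _ ((S , sep , refl) , _) k+1≤d
  with independent-exceeding? G ∣ S ∣
... | no none = inj₁ λ I ind → ℕ.≮⇒≥ λ lt → none (I , lt , ind)
... | yes (I , ∣S∣<∣I∣ , ind) with separating⇒Cut G S sep
... | A , B , cut = conclude (∣ S ∣ ℕ.≤? 1)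
  where
  ∣S∣<deg : ∀ v → ∣ S ∣ < degree G v
  ∣S∣<deg v = ℕ.≤-trans (ℕ.≤-reflexive (ℕ.+-comm 1 ∣ S ∣)) (ℕ.≤-trans k+1≤d (d≤ v))
  open Critical G (Domination.no-dominating-edge G (proj₂ (proj₁ crit)))
    (critical-dichotomy G crit λ v → map₂ proj₁ (neighbour-outside G S v (∣S∣<deg v))) S ∣S∣<deg
  -- If `S` has at least two vertices, `I` has the three that the tournament requires. Otherwise
  -- connectedness joins both sides to one cut vertex, which is impossible.
  conclude : Dec (∣ S ∣ ≤ 1) → IndependenceAtMost G ∣ S ∣ ⊎ InG233 G
  conclude (no ∣S∣≰1) = inj₂ (LargeIndependentSet.large-independent-set⇒InG233 I
    (λ {u} {v} u∈ v∈ u~v → not-¬ (ind u v u∈ v∈) u~v)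
    (ℕ.≤-trans (s≤s (ℕ.≰⇒> ∣S∣≰1)) ∣S∣<∣I∣) ∣S∣<∣I∣ cut)
  conclude (yes ∣S∣≤1) with side-meets-cut G S conn cut | side-meets-cut G S conn (cut-swap cut)
  ... | a , s , a∈ , s∈ , a~s | b , s′ , b∈ , s′∈ , b~s′ with ∣p∣≤1⇒unique S ∣S∣≤1 s∈ s′∈
  ... | refl = ⊥-elim (no-cut-vertex cut (∣p∣≤1⇒unique S ∣S∣≤1) a∈ b∈ s∈ a~s b~s′)
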